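{- Let $1\le k<n$. The Gra\ss mann-Tamari digraph $\vec G(\Delta^{NC}_{k,n})$ (defined in the context) is acyclic; hence its transitive closure, the Gra\ss mann-Tamari order $\mathcal{G}_{k,n}$ on the maximal faces of $\Delta^{NC}_{k,n}$, is a well-defined partial order. Moreover, $\mathcal{G}_{k,n}$ has a linear extension that is a shelling order of the maximal faces of $\Delta^{NC}_{k,n}$.
   Context: $V_{k,n}$ is the set of strictly increasing vectors $(i_1,\dots,i_k)$ with entries in $[n]$. Arcs $(p<p')$, $(q<q')$ cross if $p<q<p'<q'$ or $q<p<q'<p'$. $I,J\in V_{k,n}$ are noncrossing if for all $1\le a<b\le k$ with $i_\ell=j_\ell$ for all $a<\ell<b$, the arcs $(i_a<i_b)$, $(j_a<j_b)$ do not cross. $\Delta^{NC}_{k,n}$ is the flag simplicial complex on $V_{k,n}$ whose faces are the pairwise noncrossing sets; it is pure, with maximal faces of size $k(n-k)+1$. Cyclic intervals are the $k$-sets $\{c,\dots,c+k-1\}$ mod $n$, $c\in[n]$ (note $(n-k+1,\dots,n)$ is one of them). Revlex order on $\mathbb{N}^m$: $v$ precedes $w$ if the rightmost nonzero entry of $w-v$ is positive. Let $F$ be a face of size $k(n-k)$ containing all $n$ cyclic intervals (these are exactly the codimension-one faces lying in exactly two maximal faces). Its table is the list of the vectors of $F\setminus\{(n-k+1,\dots,n)\}$ written as columns in lexicographic order. Marked positions: for each row $a\in[k]$ and each $b\in[n-k]$, among the columns $(i_1,\dots,i_k)$ with $i_a=a+b-1$, the one for which $(i_1,\dots,i_a)$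 is revlex-smallest and, among those, $(i_{a+1},\dots,i_k)$ is lex-largest receives a mark in row $a$. For such $F$ exactly one column $I=(i_1,\dots,i_k)$ carries two marks, in rows $a_1<a_2$. Pushing the lower mark: put $a=a_2$, $x=i_a$; among the columns $K=(k_1,\dots,k_k)$ of the table with $k_{a-1}<x<k_a$ choose the one whose $(k_1,\dots,k_{a-1})$ is revlex-largest (leftmost in case of ties), and let $J=(k_1,\dots,k_{a-1},x,i_{a+1},\dots,i_k)$. Then $F\cup\{J\}$ is a maximal face, and the other maximal face containing $F$ is $F\cup\{J'\}$ for a unique $J'$. The Gra\ss mann-Tamari digraph $\vec G(\Delta^{NC}_{k,n})$ has as vertices the maximal faces of $\Delta^{NC}_{k,n}$ and, for each such $F$, an arc from $F\cup\{J\}$ to $F\cup\{J'\}$. A shelling order of a pure complex is an ordering $F_1,\dots,F_N$ of its maximal faces such that for each $j>1$, $F_j\cap(\bigcup_{i<j}F_i)$ (as subcomplexes) is pure of codimension one in $F_j$. -}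

module Defs where

open import Data.Nat using (ℕ; zero; suc; _+_; _*_; _∸_; _≤_; _<_; _≤?_)
open import Data.Bool using (if_then_else_)
open import Data.List using (List; []; _∷_; _++_; map; upTo; take; drop; reverse; length; lookup)
open import Data.List.Relation.Unary.All using (All)
open import Data.List.Relation.Unary.Linked using (Linked)
open import Data.List.Relation.Unary.Unique.Propositional using (Unique)
open import Data.List.Membership.Propositional using (_∈_; _∉_)
open import Data.List.Relation.Binary.Subset.Propositional using (_⊆_)
open import Data.Fin using (Fin; toℕ)
import Data.Fin as Fin
open import Data.Product using (Σ; _×_; ∃)
open import Data.Sum using (_⊎_)
open import Relation.Nullary using (¬_; does)
open import Relation.Binary.PropositionalEquality using (_≡_; _≢_)
open import Relation.Binary.Construct.Closure.Transitive using (TransClosure)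

Vect : Set
Vect = List ℕ

Face : Set
Face = List Vect

-- 1-indexed entry: at v a = i_a (and 0 out of range; only used in range)
at : Vect → ℕ → ℕ
at []       _             = 0
at (x ∷ xs) zero          = 0
at (x ∷ xs) (suc zero)    = x
at (x ∷ xs) (suc (suc m)) = at xs (suc m)

InV : ℕ → ℕ → Vect → Set
InV k n v = length v ≡ k × Linked _<_ v × All (λ x → 1 ≤ x × x ≤ n) v

Crosses : ℕ → ℕ → ℕ → ℕ → Set
Crosses p p' q q' = (p < q × q < p' × p' < q') ⊎ (q < p × p < q' × q' < p')

Noncrossing : ℕ → Vect → Vect → Set
Noncrossing k I J =
  ∀ a b → 1 ≤ a → a < b → b ≤ k →
  (∀ l → a < l → l < b → at I l ≡ at J l) →
  ¬ Crosses (at I a) (at I b) (at J a) (at J b)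

IsFace : ℕ → ℕ → Face → Set
IsFace k n F =
  Unique F × All (InV k n) F × (∀ I J → I ∈ F → J ∈ F → Noncrossing k I J)

MaxFace : ℕ → ℕ → Face → Set
MaxFace k n F = IsFace k n F × (∀ G → IsFace k n G → F ⊆ G → G ⊆ F)

_≋_ : Face → Face → Set
F ≋ G = (F ⊆ G) × (G ⊆ F)

range : ℕ → ℕ → Vect
range a m = map (a +_) (upTo m)

-- cyclic interval {c,…,c+k-1} mod n, written as an increasing vector
cyc : ℕ → ℕ → ℕ → Vect
cyc k n c =
  if does (c + k ≤? suc n)
  then range c k
  else range 1 (c + k ∸ suc n) ++ range c (suc n ∸ c)

top : ℕ → ℕ → Vect
top k n = range (suc (n ∸ k)) k

CodimOneFace : ℕ → ℕ → Face → Set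
CodimOneFace k n F =
  IsFace k n F × length F ≡ k * (n ∸ k) ×
  (∀ c → 1 ≤ c → c ≤ n → cyc k n c ∈ F)

data Lex< : Vect → Vect → Set where
  halt  : ∀ {y ys} → Lex< [] (y ∷ ys)
  here  : ∀ {x y xs ys} → x < y → Lex< (x ∷ xs) (y ∷ ys)
  there : ∀ {x xs ys} → Lex< xs ys → Lex< (x ∷ xs) (x ∷ ys)

RevLex< : Vect → Vect → Set
RevLex< v w = Lex< (reverse v) (reverse w)

-- columns of the table of F: the vectors of F other than (n-k+1,…,n)
-- (their left-to-right order is the lexicographic order Lex<)
Col : ℕ → ℕ → Face → Vect → Set
Col k n F I = I ∈ F × I ≢ top k n

-- column I receives a mark in row a (for b = i_a - a + 1 ∈ [n-k]):
-- among columns C with c_a = i_a, (i₁..i_a) is revlex-smallest and,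
-- among those, (i_{a+1}..i_k) is lex-largest
Marked : ℕ → ℕ → Face → Vect → ℕ → Set
Marked k n F I a =
  Col k n F I × 1 ≤ a × a ≤ k ×
  a ≤ at I a × at I a < a + (n ∸ k) ×
  (∀ C → Col k n F C → at C a ≡ at I a → C ≢ I →
     RevLex< (take a I) (take a C)
     ⊎ (take a I ≡ take a C × Lex< (drop a C) (drop a I)))

DoubleMarked : ℕ → ℕ → Face → Vect → ℕ → ℕ → Set
DoubleMarked k n F I a₁ a₂ = a₁ < a₂ × Marked k n F I a₁ × Marked k n F I a₂

-- the column K chosen when pushing the mark in row a with value x
PushCandidate : ℕ → ℕ → Face → ℕ → ℕ → Vect → Set
PushCandidate k n F a x K = Col k n F K × at K (a ∸ 1) < x × x < at K a

PushChoice : ℕ → ℕ → Face → ℕ → ℕ → Vect → Set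
PushChoice k n F a x K =
  PushCandidate k n F a x K ×
  (∀ K' → PushCandidate k n F a x K' → K' ≢ K →
     RevLex< (take (a ∸ 1) K') (take (a ∸ 1) K)
     ⊎ (take (a ∸ 1) K' ≡ take (a ∸ 1) K × Lex< K K'))

pushed : Vect → ℕ → Vect → Vect
pushed K a I = take (a ∸ 1) K ++ (at I a ∷ drop a I)

data Arc (k n : ℕ) (G H : Face) : Set where
  arc : (F : Face) → CodimOneFace k n F →
        (I : Vect) (a₁ a₂ : ℕ) → DoubleMarked k n F I a₁ a₂ →
        (K : Vect) → PushChoice k n F a₂ (at I a₂) K →
        (J' : Vect) → J' ≢ pushed K a₂ I → MaxFace k n (J' ∷ F) →
        MaxFace k n G → MaxFace k n H →
        G ≋ (pushed K a₂ I ∷ F) → H ≋ (J' ∷ F) →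
        Arc k n G H

Acyclic : ℕ → ℕ → Set
Acyclic k n = ∀ G → MaxFace k n G → ¬ TransClosure (Arc k n) G G

Enumerates : ℕ → ℕ → List Face → Set
Enumerates k n L =
  All (MaxFace k n) L ×
  (∀ G → MaxFace k n G → ∃ λ (i : Fin (length L)) → lookup L i ≋ G) ×
  (∀ i j → lookup L i ≋ lookup L j → i ≡ j)

LinearExtension : ℕ → ℕ → List Face → Set
LinearExtension k n L =
  ∀ i j → TransClosure (Arc k n) (lookup L i) (lookup L j) → i Fin.< j

-- faces of the subcomplex F_j ∩ (⋃_{i<j} F_i)

InSub : (L : List Face) → Fin (length L) → Face → Set
InSub L j σ =
  Unique σ × σ ⊆ lookup L j × ∃ λ i → (i Fin.< j) × σ ⊆ lookup L i

FacetOfSub : (L : List Face) → Fin (length L) → Face → Set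
FacetOfSub L j σ = InSub L j σ × (∀ τ → InSub L j τ → σ ⊆ τ → τ ⊆ σ)

-- shelling order: for j>1 the subcomplex is pure of codimension one in F_j
Shelling : List Face → Set
Shelling L = ∀ j → 1 ≤ toℕ j → ∀ σ → FacetOfSub L j σ →
  length σ + 1 ≡ length (lookup L j)

ShellingLinearExtension : ℕ → ℕ → List Face → Set
ShellingLinearExtension k n L =
  Enumerates k n L × LinearExtension k n L × Shelling L

{-# OPTIONS --safe #-}

-- Store the prefix of length r of a vector with its last entry first. Then two vectors cross iff for some
-- r their prefixes p < q (lexicographically) of length r and next entries v, w satisfy last q < v < w.
-- Hence a face is a tower of noncrossing bipartite graphs, the r-th one joining prefixes of length r to
-- next entries, and in a maximal face every level is maximal given the levels before it. As for Tamari
-- lattices, level r is determined by its bracket vector p ↦ M p, the largest entry following p. Order the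
-- maximal faces lexicographically by M, with shorter prefixes first and larger prefixes first in each
-- length. An arc of the digraph flips (p , v) to (q , w) with p < q at its first changed level, so it
-- raises M there. For the shelling, at the first difference of G < H, at a prefix q, the arc (q , M q) of H
-- can be flipped down to (p , u) with p < q and u < M q, and it is missing in G; a column of H through it,
-- or through a similar arc at a later level, can be exchanged to give a maximal face smaller than H.
module Submission where

open import Defs
open import Data.Nat using (ℕ; zero; suc; _+_; _*_; _∸_; _^_; _⊔_; _≤_; _<_; _≤?_; _<?_; z≤n; s≤s; _≟_)
open import Data.Nat.Properties
open import Data.List using (List; []; _∷_; _++_; map; concatMap; filter; upTo; downFrom; applyUpTo; take; drop; reverse; _ʳ++_; _∷ʳ_; length; lookup)
open import Data.List.Properties using (∷-injectiveˡ; ∷-injectiveʳ; ≡-dec; length-reverse; take-all; reverse-involutive; reverse-injective; reverse-++; map-upTo)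
open import Data.List.Relation.Unary.All as All using (All; []; _∷_; all?)
import Data.List.Relation.Unary.All.Properties as All
open import Data.List.Relation.Unary.Any as Any using (Any; here; there; any?)
import Data.List.Relation.Unary.Any.Properties as Any
open import Data.List.Relation.Unary.AllPairs as AllPairs using (AllPairs; []; _∷_)
import Data.List.Relation.Unary.AllPairs.Properties as AllPairs
open import Data.List.Relation.Unary.Linked as Linked using (Linked; []; [-]; _∷_)
open import Data.List.Relation.Unary.Unique.Propositional using (Unique)
import Data.List.Relation.Unary.Unique.Propositional.Properties as Unique
open import Data.List.Membership.Propositional using (_∈_; _∉_; find; lose)
open import Data.List.Membership.Propositional.Properties
open import Data.List.Relation.Binary.Subset.Propositional using (_⊆_)
open import Data.Fin as Fin using (Fin)
import Data.Fin.Properties as Fin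
open import Data.List.Relation.Binary.BagAndSetEquality using (∼bag⇒↭)
open import Data.List.Membership.Propositional.Properties.WithK using (unique∧set⇒bag)
open import Data.List.Relation.Binary.Permutation.Propositional.Properties using (↭-length)
open import Data.Product using (Σ; _×_; ∃; _,_; proj₁; proj₂)
open import Data.Sum using (_⊎_; inj₁; inj₂; [_,_]′)
open import Data.Empty using (⊥; ⊥-elim)
open import Data.Unit using (⊤; tt)
open import Function using (_∘_; id; mk⇔)
open import Relation.Nullary using (¬_; Dec; yes; no)
open import Relation.Nullary.Decidable using (_×-dec_; ¬?; map′)
open import Relation.Binary.Definitions using (tri<; tri≈; tri>)
open import Relation.Binary.PropositionalEquality using (_≡_; _≢_; refl; sym; trans; cong; cong₂; subst; subst₂)
open import Relation.Binary.Construct.Closure.Transitive using (TransClosure; [_]; _∷_)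

_≟ᵛ_ : (x y : List ℕ) → Dec (x ≡ y)
_≟ᵛ_ = ≡-dec _≟_

open import Data.List.Membership.DecPropositional _≟ᵛ_ using (_∈?_)

-- Lexicographic order

Lex<-trans : ∀ {x y z} → Lex< x y → Lex< y z → Lex< x z
Lex<-trans halt      (here _)  = halt
Lex<-trans halt      (there _) = halt
Lex<-trans (here p)  (here q)  = here (<-trans p q)
Lex<-trans (here p)  (there q) = here p
Lex<-trans (there p) (here q)  = here q
Lex<-trans (there p) (there q) = there (Lex<-trans p q)

Lex<-irrefl : ∀ {x} → ¬ Lex< x x
Lex<-irrefl (here p)  = <-irrefl refl p
Lex<-irrefl (there p) = Lex<-irrefl p

Lex<-cmp : ∀ x y → Lex< x y ⊎ x ≡ y ⊎ Lex< y x
Lex<-cmp []      []      = inj₂ (inj₁ refl)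
Lex<-cmp []      (_ ∷ _) = inj₁ halt
Lex<-cmp (_ ∷ _) []      = inj₂ (inj₂ halt)
Lex<-cmp (v ∷ p) (w ∷ q) with <-cmp v w
... | tri< a _ _ = inj₁ (here a)
... | tri> _ _ c = inj₂ (inj₂ (here c))
... | tri≈ _ refl _ with Lex<-cmp p q
...   | inj₁ l        = inj₁ (there l)
...   | inj₂ (inj₁ e) = inj₂ (inj₁ (cong (v ∷_) e))
...   | inj₂ (inj₂ g) = inj₂ (inj₂ (there g))

Lex<? : ∀ x y → Dec (Lex< x y)
Lex<? x y with Lex<-cmp x y
... | inj₁ l           = yes l
... | inj₂ (inj₁ refl) = no Lex<-irrefl
... | inj₂ (inj₂ g)    = no (λ l → Lex<-irrefl (Lex<-trans l g))

hd : List ℕ → ℕ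
hd []      = 0
hd (v ∷ _) = v

Lex<-hd : ∀ {p q} → Lex< p q → hd p ≤ hd q
Lex<-hd halt      = z≤n
Lex<-hd (here l)  = <⇒≤ l
Lex<-hd (there _) = ≤-refl

-- Maximal elements of finite lists.

module _ {A : Set} (_⊏_ : A → A → Set) (⊏? : ∀ x y → Dec (x ⊏ y))
         (⊏-trans : ∀ {x y z} → x ⊏ y → y ⊏ z → x ⊏ z) (⊏-irrefl : ∀ {x} → ¬ x ⊏ x)
         {P : A → Set} (P? : ∀ x → Dec (P x)) where

  maximal : ∀ xs → Any P xs → ∃ λ x → x ∈ xs × P x × (∀ y → y ∈ xs → P y → ¬ x ⊏ y)
  maximal (z ∷ xs) a with any? P? xs | P? z | a
  ... | no  n | yes pz | _ = z , here refl , pz , λ where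
    y (here refl) _  → ⊏-irrefl
    y (there m)   py → ⊥-elim (n (lose m py))
  ... | no  n | no ¬pz | here pz = ⊥-elim (¬pz pz)
  ... | no  n | no ¬pz | there b = ⊥-elim (n b)
  ... | yes b | no ¬pz | _ with maximal xs b
  ...   | x , m , px , mx = x , there m , px , λ where
    y (here refl) py → ⊥-elim (¬pz py)
    y (there m′)  py → mx y m′ py
  maximal (z ∷ xs) a | yes b | yes pz | _ with maximal xs b
  ...   | x , m , px , mx with ⊏? x z
  ...     | no x⊀z = x , there m , px , λ where
    y (here refl) _  → x⊀z
    y (there m′)  py → mx y m′ py
  ...     | yes x⊏z = z , here refl , pz , λ where
    y (here refl) _  → ⊏-irrefl
    y (there m′)  py z⊏y → mx y m′ py (⊏-trans x⊏z z⊏y)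

-- Reversed prefixes

pre : Vect → ℕ → List ℕ
pre x zero    = []
pre x (suc r) = at x (suc r) ∷ pre x r

length-pre : ∀ x r → length (pre x r) ≡ r
length-pre x zero    = refl
length-pre x (suc r) = cong suc (length-pre x r)

at-zero : ∀ x → at x 0 ≡ 0
at-zero []      = refl
at-zero (_ ∷ _) = refl

hd-pre : ∀ x r → hd (pre x r) ≡ at x r
hd-pre x zero    = sym (at-zero x)
hd-pre x (suc r) = refl

pre-cong : ∀ {x y} r → (∀ l → l ≤ r → at x l ≡ at y l) → pre x r ≡ pre y r
pre-cong zero    f = refl
pre-cong (suc r) f = cong₂ _∷_ (f (suc r) ≤-refl) (pre-cong r (λ l l≤r → f l (m≤n⇒m≤1+n l≤r)))

pre-≤ : ∀ {x y} {c r} → c ≤ r → pre x r ≡ pre y r → pre x c ≡ pre y c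
pre-≤ {c = c} {r} c≤r e with m≤n⇒m<n∨m≡n c≤r
pre-≤ {c = c} {suc r} c≤r e | inj₁ (s≤s c≤r′) = pre-≤ c≤r′ (∷-injectiveʳ e)
... | inj₂ refl = e

take-suc-at : ∀ x r → r < length x → take (suc r) x ≡ take r x ∷ʳ at x (suc r)
take-suc-at (v ∷ x) zero    _       = refl
take-suc-at (v ∷ w ∷ x) (suc r) (s≤s l) = cong (v ∷_) (take-suc-at (w ∷ x) r l)
take-suc-at (v ∷ []) (suc r) (s≤s ())

pre-take : ∀ x r → r ≤ length x → pre x r ≡ reverse (take r x)
pre-take x zero    _ = refl
pre-take x (suc r) l = sym (trans (cong reverse (take-suc-at x r l))
  (trans (reverse-++ (take r x) _) (cong (at x (suc r) ∷_) (sym (pre-take x r (<⇒≤ l))))))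

pre-all : ∀ x → pre x (length x) ≡ reverse x
pre-all x = trans (pre-take x (length x) ≤-refl) (cong reverse (take-all (length x) x ≤-refl))

pre-reverse : ∀ s → pre (reverse s) (length s) ≡ s
pre-reverse s = trans (cong (pre (reverse s)) (sym (length-reverse s)))
                  (trans (pre-all (reverse s)) (reverse-involutive s))

pre-injective : ∀ {k x y} → length x ≡ k → length y ≡ k → pre x k ≡ pre y k → x ≡ y
pre-injective {x = x} {y} refl ly e =
  reverse-injective (trans (sym (pre-all x)) (trans e (trans (cong (pre y) (sym ly)) (pre-all y))))

first-difference : ∀ {x y} r m → pre x r ≡ pre y r → pre x (m + r) ≢ pre y (m + r) →
  ∃ λ c → r ≤ c × c < m + r × pre x c ≡ pre y c × at x (suc c) ≢ at y (suc c)
first-difference r zero e ne = ⊥-elim (ne e)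
first-difference {x} {y} r (suc m) e ne with pre x (m + r) ≟ᵛ pre y (m + r)
... | yes e′ = m + r , m≤n+m r m , ≤-refl , e′ , λ a → ne (cong₂ _∷_ a e′)
... | no ne′ with first-difference r m e ne′
...   | c , r≤c , c< , e′ , d = c , r≤c , m≤n⇒m≤1+n c< , e′ , d

pre-difference : ∀ {k x y} r → r ≤ k → length x ≡ k → length y ≡ k → x ≢ y → pre x r ≡ pre y r →
  ∃ λ c → r ≤ c × c < k × pre x c ≡ pre y c × at x (suc c) ≢ at y (suc c)
pre-difference {k} {x} {y} r r≤k lx ly x≢y e with m∸n+n≡m r≤k
... | q with first-difference {x} {y} r (k ∸ r) e (λ e′ → x≢y (pre-injective lx ly (subst (λ z → pre x z ≡ pre y z) q e′)))
...   | c , r≤c , c< , e′ , d = c , r≤c , subst (c <_) q c< , e′ , d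

-- The leading difference of two reversed prefixes is the last difference of the prefixes. It is the
-- left end of two arcs with agreement in between, as `Noncrossing` asks.
Lex<-pre⁻ : ∀ x y c → Lex< (pre x c) (pre y c) →
  ∃ λ a → 1 ≤ a × a ≤ c × at x a < at y a × (∀ l → a < l → l ≤ c → at x l ≡ at y l)
Lex<-pre⁻ x y (suc c) l = go l refl refl
  where
  go : ∀ {p q} → Lex< p q → p ≡ pre x (suc c) → q ≡ pre y (suc c) → 
    ∃ λ a → 1 ≤ a × a ≤ suc c × at x a < at y a × (∀ l → a < l → l ≤ suc c → at x l ≡ at y l)
  go (here v<w) refl refl = suc c , s≤s z≤n , ≤-refl , v<w , λ l c<l l≤c → ⊥-elim (<⇒≱ c<l l≤c)
  go (there l) e₁ e₂ with Lex<-pre⁻ x y c (subst₂ Lex< (∷-injectiveʳ e₁) (∷-injectiveʳ e₂) l)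
  ... | a , 1≤a , a≤c , lt , eq = a , 1≤a , m≤n⇒m≤1+n a≤c , lt , λ l a<l l≤c → [ (λ l<c → eq l a<l (≤-pred l<c)) , (λ where refl → trans (sym (∷-injectiveˡ e₁)) (∷-injectiveˡ e₂)) ]′ (m≤n⇒m<n∨m≡n l≤c)

Lex<-pre⁺ : ∀ x y a c → a < suc c → (∀ l → suc a < l → l ≤ suc c → at x l ≡ at y l) → at x (suc a) < at y (suc a) →
  Lex< (pre x (suc c)) (pre y (suc c))
Lex<-pre⁺ x y a c a<c eq lt with m≤n⇒m<n∨m≡n (≤-pred a<c)
Lex<-pre⁺ x y a c a<c eq lt | inj₂ refl = here lt
Lex<-pre⁺ x y a (suc c) a<c eq lt | inj₁ a<c′ =
  subst (λ z → Lex< (z ∷ pre x (suc c)) (pre y (suc (suc c)))) (sym (eq (suc (suc c)) (s≤s a<c′) ≤-refl))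
    (there (Lex<-pre⁺ x y a c a<c′ (λ l a<l l≤c → eq l a<l (m≤n⇒m≤1+n l≤c)) lt))

-- Columns and nodes

-- The arcs that prolong p by v and q by w cross.
Bad : List ℕ → ℕ → List ℕ → ℕ → Set
Bad p v q w = Lex< p q × hd q < v × v < w

-- For d = n - k the bound leaves room to prolong the prefix to k increasing entries in [n].
data Valid (d : ℕ) : List ℕ → Set where
  []  : Valid d []
  _∷_ : ∀ {v p} → hd p < v × v ≤ d + suc (length p) → Valid d p → Valid d (v ∷ p)

Node : Face → ℕ → List ℕ → Set
Node F r s = ∃ λ x → x ∈ F × pre x r ≡ s

Node-⊆ : ∀ {F G r s} → F ⊆ G → Node F r s → Node G r s
Node-⊆ F⊆G (x , x∈F , e) = x , F⊆G x∈F , e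

Node-tail : ∀ {F r v p} → Node F (suc r) (v ∷ p) → Node F r p
Node-tail (x , x∈F , e) = x , x∈F , ∷-injectiveʳ e

length-node : ∀ {F r s} → Node F r s → length s ≡ r
length-node {r = r} (x , _ , refl) = length-pre x r

at-lookup-step : ∀ x c → Linked _<_ x → suc c < length x → at x (suc c) < at x (suc (suc c))
at-lookup-step (v ∷ [])    c       l           (s≤s ())
at-lookup-step (v ∷ w ∷ x) zero    (v<w ∷ l)   _        = v<w
at-lookup-step (v ∷ w ∷ x) (suc c) (v<w ∷ l)   (s≤s c<) = at-lookup-step (w ∷ x) c l c<

at-All : ∀ {P : ℕ → Set} x c → All P x → c < length x → P (at x (suc c))
at-All (v ∷ x)     zero    (p ∷ _)  _       = p
at-All (v ∷ w ∷ x) (suc c) (_ ∷ ps) (s≤s l) = at-All (w ∷ x) c ps l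
at-All (v ∷ [])    (suc c) _ (s≤s ())

ʳ++-Linked : ∀ {d s v acc} → Valid d s → hd s < v → Linked _<_ (v ∷ acc) → Linked _<_ (s ʳ++ (v ∷ acc))
ʳ++-Linked []               _   l = l
ʳ++-Linked ((h , _) ∷ val) s<v l = ʳ++-Linked val h (s<v ∷ l)

reverse-Linked : ∀ {d s} → Valid d s → Linked _<_ (reverse s)
reverse-Linked []              = []
reverse-Linked ((h , _) ∷ val) = ʳ++-Linked val h [-]

Valid-All : ∀ {d s} → Valid d s → All (λ v → 1 ≤ v × v ≤ d + length s) s
Valid-All []              = []
Valid-All {d} {v ∷ p} ((h , b) ∷ val) =
  (≤-trans (s≤s z≤n) h , b) ∷ All.map (λ (a , c) → a , ≤-trans c (+-monoʳ-≤ d (n≤1+n _))) (Valid-All val)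

length≤hd : ∀ {d s} → Valid d s → length s ≤ hd s
length≤hd []            = z≤n
length≤hd ((h , _) ∷ v) = ≤-trans (s≤s (length≤hd v)) h

hd≤ : ∀ {d s} → Valid d s → hd s ≤ d + length s
hd≤ []            = z≤n
hd≤ ((_ , b) ∷ _) = b

first : ℕ → List ℕ
first zero    = []
first (suc r) = suc r ∷ first r

length-first : ∀ r → length (first r) ≡ r
length-first zero    = refl
length-first (suc r) = cong suc (length-first r)

hd-first : ∀ r → hd (first r) ≡ r
hd-first zero    = refl
hd-first (suc r) = refl

Valid-first : ∀ d r → Valid d (first r)
Valid-first d zero    = []
Valid-first d (suc r) =
  (subst (_< suc r) (sym (hd-first r)) ≤-refl , subst (λ z → suc r ≤ d + suc z) (sym (length-first r)) (m≤n+m _ d))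
  ∷ Valid-first d r

-- A strictly increasing word of positive numbers has at least r at position r.
first-min : ∀ {d s} → Valid d s → ¬ Lex< s (first (length s))
first-min ((h , _) ∷ val) (here v<)  = <⇒≱ v< (≤-trans (s≤s (length≤hd val)) h)
first-min (_ ∷ val)       (there l)  = first-min val l

hd≤length⇒first : ∀ {d s} → Valid d s → hd s ≤ length s → s ≡ first (length s)
hd≤length⇒first [] _ = refl
hd≤length⇒first {s = v ∷ p} ((h , _) ∷ val) v≤ =
  cong₂ _∷_ (≤-antisym v≤ (≤-trans (s≤s (length≤hd val)) h)) (hd≤length⇒first val (≤-pred (≤-trans h v≤)))

-- The recursion tests every level of the prefix, because the crossing of two columns splits into
-- one `Bad` test for each level.
Compat : Face → List ℕ → Set
Compat F []      = ⊤
Compat F (v ∷ p) = Compat F p ×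
  (∀ {w q} → Node F (suc (length p)) (w ∷ q) → ¬ Bad p v q w × ¬ Bad q w p v)

value : List ℕ → Vect → ℕ
value p x with pre x (length p) ≟ᵛ p
... | yes _ = at x (suc (length p))
... | no  _ = 0

-- The bracket vector of Tamari lattices, with value 0 if no column of F prolongs p.
M : Face → List ℕ → ℕ
M []      p = 0
M (x ∷ F) p = value p x ⊔ M F p

M-upper : ∀ {F r v p} → Node F (suc r) (v ∷ p) → v ≤ M F p
M-upper {x ∷ F} {r} {p = p} (x , here refl , refl) with pre x (length p) ≟ᵛ p
... | yes _ rewrite length-pre x r = m≤m⊔n _ _
... | no ne = ⊥-elim (ne (cong (pre x) (length-pre x r)))
M-upper {y ∷ F} {p = p} (x , there x∈F , e) = ≤-trans (M-upper (x , x∈F , e)) (m≤n⊔m (value p y) _)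

M-attained : ∀ F p → M F p ≡ 0 ⊎ Node F (suc (length p)) (M F p ∷ p)
M-attained []      p = inj₁ refl
M-attained (x ∷ F) p with ⊔-sel (value p x) (M F p)
... | inj₂ e rewrite e with M-attained F p
...   | inj₁ z = inj₁ z
...   | inj₂ nd = inj₂ (Node-⊆ there nd)
M-attained (x ∷ F) p | inj₁ e rewrite e with pre x (length p) ≟ᵛ p
... | yes q = inj₂ (x , here refl , cong (at x (suc (length p)) ∷_) q)
... | no _ = inj₁ refl

M-bounded : ∀ {F p b} → (∀ {v} → Node F (suc (length p)) (v ∷ p) → v ≤ b) → M F p ≤ b
M-bounded {F} {p} h with M-attained F p
... | inj₁ z rewrite z = z≤n
... | inj₂ nd = h nd

M-mono : ∀ {F G} p → F ⊆ G → M F p ≤ M G p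
M-mono {F} {G} p F⊆G = M-bounded {F} {p} (λ nd → M-upper {r = length p} (Node-⊆ {F} F⊆G nd))

-- Numbering by a lexicographic comparison of functions

-- `downFrom` makes the list descending, in accordance with `≺`.
words : ℕ → ℕ → List (List ℕ)
words b zero    = [] ∷ []
words b (suc r) = concatMap (λ v → map (v ∷_) (words b r)) (downFrom (suc b))

∈-words⁺ : ∀ {b s} → All (_≤ b) s → s ∈ words b (length s)
∈-words⁺ []           = here refl
∈-words⁺ {b} {v ∷ p} (v≤b ∷ a) =
  ∈-concatMap⁺ (λ v → map (v ∷_) (words b (length p))) (lose (∈-downFrom⁺ (s≤s v≤b)) (∈-map⁺ (v ∷_) (∈-words⁺ a)))

∈-words⁻ : ∀ {b s} r → s ∈ words b r → length s ≡ r
∈-words⁻ zero    (here refl) = refl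
∈-words⁻ {b} (suc r) m with find (∈-concatMap⁻ (λ v → map (v ∷_) (words b r)) {xs = downFrom (suc b)} m)
... | v , _ , m′ with ∈-map⁻ (v ∷_) m′
...   | p , p∈ , refl = cong suc (∈-words⁻ r p∈)

words-descending : ∀ b r → AllPairs (λ p q → Lex< q p) (words b r)
words-descending b zero    = [] ∷ []
words-descending b (suc r) = AllPairs.concat⁺
  (All.map⁺ (All.tabulate (λ _ → AllPairs.map⁺ (AllPairs.map there (words-descending b r)))))
  (AllPairs.map⁺ (AllPairs.applyDownFrom⁺₁ id (suc b) (λ j<i _ →
    All.map⁺ (All.tabulate (λ _ → All.map⁺ (All.tabulate (λ _ → here j<i)))))))

-- In one length larger prefixes come first: what bounds an entry after p from above in terms of
-- brackets are arcs at prefixes q with p < q or the bracket of p itself.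
_≺_ : List ℕ → List ℕ → Set
p ≺ q = length p < length q ⊎ (length p ≡ length q × Lex< q p)

≺-irrefl : ∀ {p} → ¬ p ≺ p
≺-irrefl (inj₁ l)       = <-irrefl refl l
≺-irrefl (inj₂ (_ , l)) = Lex<-irrefl l

≺-asym : ∀ {p q} → p ≺ q → ¬ q ≺ p
≺-asym (inj₁ a)       (inj₁ b)       = <-asym a b
≺-asym (inj₁ a)       (inj₂ (b , _)) = <-irrefl (sym b) a
≺-asym (inj₂ (a , _)) (inj₁ b)       = <-irrefl (sym a) b
≺-asym (inj₂ (_ , a)) (inj₂ (_ , b)) = Lex<-irrefl (Lex<-trans a b)

module _ (n : ℕ) where

  -- The values of `f` serve as digits in base n + 1. As long as they are at most n, comparing
  -- numbers is comparing functions lexicographically along the list.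
  number : (List ℕ → ℕ) → List (List ℕ) → ℕ
  number f []       = 0
  number f (p ∷ ps) = f p * suc n ^ length ps + number f ps

  number-< : ∀ {f} ps → (∀ {p} → p ∈ ps → f p ≤ n) → number f ps < suc n ^ length ps
  number-< []       _ = s≤s z≤n
  number-< {f} (p ∷ ps) b = begin-strict
    f p * B + number f ps <⟨ +-monoʳ-< (f p * B) (number-< ps (b ∘ there)) ⟩
    f p * B + B           ≡⟨ +-comm (f p * B) B ⟩
    suc (f p) * B         ≤⟨ *-monoˡ-≤ B (s≤s (b (here refl))) ⟩
    suc n * B ∎
    where
    open ≤-Reasoning
    B : ℕ
    B = suc n ^ length ps

  head-< : ∀ {f g p} ps → (∀ {q} → q ∈ ps → f q ≤ n) → f p < g p → number f (p ∷ ps) < number g (p ∷ ps)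
  head-< {f} {g} {p} ps b lt = begin-strict
    f p * B + number f ps <⟨ +-monoʳ-< (f p * B) (number-< ps b) ⟩
    f p * B + B           ≡⟨ +-comm (f p * B) B ⟩
    suc (f p) * B         ≤⟨ *-monoˡ-≤ B lt ⟩
    g p * B               ≤⟨ m≤m+n _ _ ⟩
    g p * B + number g ps ∎
    where
    open ≤-Reasoning
    B : ℕ
    B = suc n ^ length ps

  -- A weak inequality before `p` suffices, since a strict one met there decides the comparison
  -- already.
  number-<⁺ : ∀ {f g p} ps → AllPairs _≺_ ps → (∀ {q} → q ∈ ps → f q ≤ n) → p ∈ ps →
    (∀ {q} → q ∈ ps → q ≺ p → f q ≤ g q) → f p < g p → number f ps < number g ps
  number-<⁺ (p ∷ ps) _        b (here refl) le lt = head-< ps (b ∘ there) lt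
  number-<⁺ {f} {g} (p ∷ ps) (o ∷ os) b (there m)   le lt with m≤n⇒m<n∨m≡n (le (here refl) (All.lookup o m))
  ... | inj₁ lt′ = head-< ps (b ∘ there) lt′
  ... | inj₂ e rewrite e = +-monoʳ-< (g p * _) (number-<⁺ ps os (b ∘ there) m (le ∘ there) lt)

  number-<⁻ : ∀ {f g} ps → AllPairs _≺_ ps → (∀ {q} → q ∈ ps → g q ≤ n) → number f ps < number g ps →
    ∃ λ p → p ∈ ps × f p < g p × (∀ {q} → q ∈ ps → q ≺ p → f q ≡ g q)
  number-<⁻ {f} {g} (p ∷ ps) (o ∷ os) b lt with <-cmp (f p) (g p)
  ... | tri< a _ _ = p , here refl , a , λ where
    (here refl) q≺p → ⊥-elim (≺-irrefl q≺p)
    (there m)   q≺p → ⊥-elim (≺-asym q≺p (All.lookup o m))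
  ... | tri> _ _ c = ⊥-elim (<-asym lt (head-< ps (b ∘ there) c))
  ... | tri≈ _ e _ with number-<⁻ ps os (b ∘ there) (+-cancelˡ-< (g p * suc n ^ length ps) _ _ (subst (λ z → z * suc n ^ length ps + number f ps < number g (p ∷ ps)) e lt))
  ...   | p′ , m , lt′ , eq = p′ , there m , lt′ , λ where
    (here refl) _   → e
    (there m′)  q≺p → eq m′ q≺p

  number-≡⁻ : ∀ {f g} ps → (∀ {p} → p ∈ ps → f p ≤ n) → (∀ {p} → p ∈ ps → g p ≤ n) →
    number f ps ≡ number g ps → ∀ {p} → p ∈ ps → f p ≡ g p
  number-≡⁻ {f} {g} (p ∷ ps) b b′ e m with <-cmp (f p) (g p)
  ... | tri< a _ _ = ⊥-elim (<-irrefl e (head-< ps (b ∘ there) a))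
  ... | tri> _ _ c = ⊥-elim (<-irrefl (sym e) (head-< ps (b′ ∘ there) c))
  number-≡⁻ {f} {g} (p ∷ ps) b b′ e (here refl) | tri≈ _ e′ _ = e′
  number-≡⁻ {f} {g} (p ∷ ps) b b′ e (there m)   | tri≈ _ e′ _ =
    number-≡⁻ ps (b ∘ there) (b′ ∘ there)
      (+-cancelˡ-≡ (g p * suc n ^ length ps) _ _ (subst (λ z → z * suc n ^ length ps + number f ps ≡ number g (p ∷ ps)) e′ e)) m

  number-cong : ∀ {f g} ps → (∀ p → f p ≡ g p) → number f ps ≡ number g ps
  number-cong []       e = refl
  number-cong (p ∷ ps) e = cong₂ (λ a b → a * suc n ^ length ps + b) (e p) (number-cong ps e)

-- Sublists and sorting by a numerical key.

subsets : ∀ {A : Set} → List A → List (List A)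
subsets []       = [] ∷ []
subsets (x ∷ xs) = subsets xs ++ map (x ∷_) (subsets xs)

filter-∈-subsets : ∀ {A : Set} {P : A → Set} (P? : ∀ x → Dec (P x)) xs → filter P? xs ∈ subsets xs
filter-∈-subsets P? []       = here refl
filter-∈-subsets P? (x ∷ xs) with P? x
... | yes _ = ∈-++⁺ʳ (subsets xs) (∈-map⁺ (x ∷_) (filter-∈-subsets P? xs))
... | no  _ = ∈-++⁺ˡ (filter-∈-subsets P? xs)

AllPairs-lookup : ∀ {A : Set} {R : A → A → Set} {xs : List A} → AllPairs R xs →
  ∀ {i j} → i Fin.< j → R (lookup xs i) (lookup xs j)
AllPairs-lookup {xs = _ ∷ xs} (o ∷ os) {Fin.zero}  {Fin.suc j} _ = All.lookup o (∈-lookup j)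
AllPairs-lookup (o ∷ os) {Fin.suc i} {Fin.suc j} (s≤s l) = AllPairs-lookup os l

module Insertion {A : Set} (f : A → ℕ) where

  -- An element whose key is already present is dropped, which keeps the list strictly increasing.
  insert : A → List A → List A
  insert x [] = x ∷ []
  insert x (y ∷ ys) with <-cmp (f x) (f y)
  ... | tri< _ _ _ = x ∷ y ∷ ys
  ... | tri≈ _ _ _ = y ∷ ys
  ... | tri> _ _ _ = y ∷ insert x ys

  insert-All : ∀ {P : A → Set} {x} ys → P x → All P ys → All P (insert x ys)
  insert-All [] px _ = px ∷ []
  insert-All {x = x} (y ∷ ys) px (py ∷ pys) with <-cmp (f x) (f y)
  ... | tri< _ _ _ = px ∷ py ∷ pys
  ... | tri≈ _ _ _ = py ∷ pys
  ... | tri> _ _ _ = py ∷ insert-All ys px pys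

  insert-sorted : ∀ {x} ys → AllPairs (λ a b → f a < f b) ys → AllPairs (λ a b → f a < f b) (insert x ys)
  insert-sorted [] _ = [] ∷ []
  insert-sorted {x} (y ∷ ys) (o ∷ os) with <-cmp (f x) (f y)
  ... | tri< a _ _ = (a ∷ All.map (<-trans a) o) ∷ o ∷ os
  ... | tri≈ _ _ _ = o ∷ os
  ... | tri> _ _ c = insert-All ys c o ∷ insert-sorted ys os

  insert-∋ : ∀ {x} ys → ∃ λ y → y ∈ insert x ys × f y ≡ f x
  insert-∋ {x} [] = x , here refl , refl
  insert-∋ {x} (y ∷ ys) with <-cmp (f x) (f y)
  ... | tri< _ _ _ = x , here refl , refl
  ... | tri≈ _ e _ = y , here refl , sym e
  ... | tri> _ _ _ with insert-∋ {x} ys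
  ...   | z , m , e = z , there m , e

  insert-⊆ : ∀ {x} ys → ys ⊆ insert x ys
  insert-⊆ {x} (y ∷ ys) m with <-cmp (f x) (f y)
  insert-⊆ (y ∷ ys) m           | tri< _ _ _ = there m
  insert-⊆ (y ∷ ys) m           | tri≈ _ _ _ = m
  insert-⊆ (y ∷ ys) (here e)    | tri> _ _ _ = here e
  insert-⊆ (y ∷ ys) (there m)   | tri> _ _ _ = there (insert-⊆ ys m)

  sort : List A → List A
  sort []       = []
  sort (x ∷ xs) = insert x (sort xs)

  sort-All : ∀ {P : A → Set} xs → All P xs → All P (sort xs)
  sort-All []       _        = []
  sort-All (x ∷ xs) (p ∷ ps) = insert-All (sort xs) p (sort-All xs ps)

  sort-sorted : ∀ xs → AllPairs (λ a b → f a < f b) (sort xs)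
  sort-sorted []       = []
  sort-sorted (x ∷ xs) = insert-sorted (sort xs) (sort-sorted xs)

  sort-∋ : ∀ {x} xs → x ∈ xs → ∃ λ y → y ∈ sort xs × f y ≡ f x
  sort-∋ (x ∷ xs) (here refl) = insert-∋ (sort xs)
  sort-∋ (x ∷ xs) (there m) with sort-∋ xs m
  ... | y , m′ , e = y , insert-⊆ (sort xs) m′ , e

-- Entries of the last interval and of pushed columns.

at-applyUpTo : ∀ (f : ℕ → ℕ) k c → c < k → at (applyUpTo f k) (suc c) ≡ f c
at-applyUpTo f (suc k)       zero    _       = refl
at-applyUpTo f (suc (suc k)) (suc c) (s≤s l) = at-applyUpTo (f ∘ suc) (suc k) c l
at-applyUpTo f (suc zero)    (suc c) (s≤s ())

at-top : ∀ k n c → c < k → at (top k n) (suc c) ≡ suc (n ∸ k) + c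
at-top k n c c<k = trans (cong (λ z → at z (suc c)) (map-upTo (suc (n ∸ k) +_) k)) (at-applyUpTo (suc (n ∸ k) +_) k c c<k)

take-++-take : ∀ r (K ys : Vect) → r ≤ length K → take r (take r K ++ ys) ≡ take r K
take-++-take zero    K       ys _       = refl
take-++-take (suc r) (v ∷ K) ys (s≤s l) = cong (v ∷_) (take-++-take r K ys l)

at-take-++ : ∀ r K v ys → r ≤ length K → at (take r K ++ (v ∷ ys)) (suc r) ≡ v
at-take-++ zero          K           v ys _       = refl
at-take-++ (suc zero)    (w ∷ K)     v ys _       = refl
at-take-++ (suc (suc r)) (w ∷ z ∷ K) v ys (s≤s l) = at-take-++ (suc r) (z ∷ K) v ys l
at-take-++ (suc (suc r)) (w ∷ [])    v ys (s≤s ())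

take-at-drop : ∀ r I → r < length I → take r I ++ (at I (suc r) ∷ drop (suc r) I) ≡ I
take-at-drop zero    (v ∷ I)     _       = refl
take-at-drop (suc r) (v ∷ w ∷ I) (s≤s l) = cong (v ∷_) (take-at-drop r (w ∷ I) l)
take-at-drop (suc r) (v ∷ [])    (s≤s ())

length-take-++ : ∀ r (K ys : Vect) → r ≤ length K → r ≤ length (take r K ++ ys)
length-take-++ zero    K       ys _       = z≤n
length-take-++ (suc r) (v ∷ K) ys (s≤s l) = s≤s (length-take-++ r K ys l)

pre-pushed : ∀ r K ys → r ≤ length K → pre (take r K ++ ys) r ≡ pre K r
pre-pushed r K ys l = trans (pre-take _ r (length-take-++ r K ys l))
  (trans (cong reverse (take-++-take r K ys l)) (sym (pre-take K r l)))

-- Crossing of columns in terms of their prefixes.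

module Complex (k n : ℕ) (k<n : k < n) where

  d : ℕ
  d = n ∸ k

  d+k : d + k ≡ n
  d+k = m∸n+n≡m (<⇒≤ k<n)

  module _ {x} (X : InV k n x) where
    private
      len : length x ≡ k
      len = proj₁ X

    at-step : ∀ {c} → c < k → at x c < at x (suc c)
    at-step {zero}  c<k = subst (_< at x 1) (sym (at-zero x))
      (proj₁ (at-All x 0 (proj₂ (proj₂ X)) (subst (0 <_) (sym len) c<k)))
    at-step {suc c} c<k = at-lookup-step x c (proj₁ (proj₂ X)) (subst (suc c <_) (sym len) c<k)

    at-mono-≤ : ∀ {a b} → a ≤ b → b ≤ k → at x a ≤ at x b
    at-mono-≤ {a} {b} a≤b b≤k with m≤n⇒m<n∨m≡n a≤b
    ... | inj₂ refl = ≤-refl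
    at-mono-≤ {a} {suc b} a≤b b≤k | inj₁ (s≤s a≤b′) =
      ≤-trans (at-mono-≤ a≤b′ (<⇒≤ b≤k)) (<⇒≤ (at-step b≤k))

    at≤n : ∀ {c} → c ≤ k → at x c ≤ n
    at≤n {zero}  _   = subst (_≤ n) (sym (at-zero x)) z≤n
    at≤n {suc c} c<k = proj₂ (at-All x c (proj₂ (proj₂ X)) (subst (c <_) (sym len) c<k))

    -- The last entry is at most n, and each step to the left lowers the entry by at least 1; `m`
    -- counts these steps.
    at-bound : ∀ m {c} → c + m ≡ k → at x c ≤ d + c
    at-bound zero    {c} e = subst (at x c ≤_) (trans (sym d+k) (cong (d +_) (trans (sym e) (+-identityʳ c))))
                               (at≤n (≤-reflexive (trans (sym (+-identityʳ c)) e)))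
    at-bound (suc m) {c} e = ≤-pred (≤-trans (at-step c<k) (subst (at x (suc c) ≤_) (+-suc d c) (at-bound m (trans (sym (+-suc c m)) e))))
      where
      c<k : c < k
      c<k = subst (c <_) e (m<m+n c (s≤s z≤n))

    at-upper : ∀ {c} → c ≤ k → at x c ≤ d + c
    at-upper {c} c≤k = at-bound (k ∸ c) (m+[n∸m]≡n c≤k)

    pre-Valid : ∀ {r} → r ≤ k → Valid d (pre x r)
    pre-Valid {zero}  _   = []
    pre-Valid {suc r} r<k =
      (subst (_< at x (suc r)) (sym (hd-pre x r)) (at-step r<k) ,
       subst (λ z → at x (suc r) ≤ d + suc z) (sym (length-pre x r)) (at-upper r<k)) ∷ pre-Valid (<⇒≤ r<k)

  reverse-InV : ∀ {s} → Valid d s → length s ≡ k → InV k n (reverse s)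
  reverse-InV {s} val refl = length-reverse s , reverse-Linked val ,
    All.tabulate (λ m → All.lookup (subst (λ b → All (λ v → 1 ≤ v × v ≤ b) s) d+k (Valid-All val)) (reverse∈ m))
    where
    reverse∈ : ∀ {v} → v ∈ reverse s → v ∈ s
    reverse∈ = Any.reverse⁻

  NoBad : Vect → Vect → Set
  NoBad x y = ∀ c → c < k → ¬ Bad (pre x c) (at x (suc c)) (pre y c) (at y (suc c))

  -- The last position a where the two prefixes differ gives the crossing arcs, from a to c + 1.
  noncrossing⇒NoBad : ∀ {x y} → InV k n x → InV k n y → Noncrossing k x y → NoBad x y
  noncrossing⇒NoBad {x} {y} X Y nc c c<k (l , h , lt) with Lex<-pre⁻ x y c l
  ... | a , 1≤a , a≤c , xa<ya , eq =
    nc a (suc c) 1≤a (s≤s a≤c) c<k (λ l a<l l≤c → eq l a<l (≤-pred l≤c))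
      (inj₁ (xa<ya , ≤-<-trans (at-mono-≤ Y a≤c (<⇒≤ c<k)) (subst (_< at x (suc c)) (hd-pre y c) h) , lt))

  -- `Bad` uses the last entry of the prefix of `y` in place of the entry at the left end of the
  -- arc. Either these coincide, or `x` has the same last entry there and its next entry is larger
  -- anyway.
  arc-Bad : ∀ {x y} → InV k n x → NoBad x y → ∀ a b → 1 ≤ a → a < b → b ≤ k →
    (∀ l → a < l → l < b → at x l ≡ at y l) →
    ¬ (at x a < at y a × at y a < at x b × at x b < at y b)
  arc-Bad {x} {y} X nb (suc a) (suc (suc c)) _ (s≤s (s≤s a<)) b≤k eq (xa<ya , ya<xb , xb<yb) =
    nb (suc c) b≤k (Lex<-pre⁺ x y a c (s≤s a<) (λ l a<l l≤c → eq l a<l (s≤s l≤c)) xa<ya , below , xb<yb)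
    where
    below : at y (suc c) < at x (suc (suc c))
    below with m≤n⇒m<n∨m≡n a<
    ... | inj₂ refl = ya<xb
    ... | inj₁ a<c = subst (_< at x (suc (suc c))) (eq (suc c) (s≤s a<c) ≤-refl) (at-step X b≤k)

  NoBad⇒noncrossing : ∀ {x y} → InV k n x → InV k n y → NoBad x y → NoBad y x → Noncrossing k x y
  NoBad⇒noncrossing X Y nb nb′ a b 1≤a a<b b≤k eq (inj₁ c) = arc-Bad X nb a b 1≤a a<b b≤k eq c
  NoBad⇒noncrossing X Y nb nb′ a b 1≤a a<b b≤k eq (inj₂ c) =
    arc-Bad Y nb′ a b 1≤a a<b b≤k (λ l p q → sym (eq l p q)) c

  Noncrossing-refl : ∀ x → Noncrossing k x x
  Noncrossing-refl x a b _ _ _ _ (inj₁ (p , _)) = <-irrefl refl p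
  Noncrossing-refl x a b _ _ _ _ (inj₂ (p , _)) = <-irrefl refl p

  -- Nodes of a face, and completion of prefixes to columns.

  NoncrossingWith : Face → Vect → Set
  NoncrossingWith F x = ∀ {y} → y ∈ F → Noncrossing k x y × Noncrossing k y x

  module _ {F} (face : IsFace k n F) where

    face-InV : ∀ {x} → x ∈ F → InV k n x
    face-InV = All.lookup (proj₁ (proj₂ face))

    no-cross : ∀ {c v p w q} → c < k → Node F (suc c) (v ∷ p) → Node F (suc c) (w ∷ q) → ¬ Bad p v q w
    no-cross {c} c<k (x , x∈F , refl) (y , y∈F , refl) =
      noncrossing⇒NoBad (face-InV x∈F) (face-InV y∈F) (proj₂ (proj₂ face) x y x∈F y∈F) c c<k

    node-Valid : ∀ {r s} → r ≤ k → Node F r s → Valid d s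
    node-Valid r≤k (x , x∈F , refl) = pre-Valid (face-InV x∈F) r≤k

    node-< : ∀ {c v p} → c < k → Node F (suc c) (v ∷ p) → hd p < v
    node-< c<k nd with node-Valid c<k nd
    ... | (h , _) ∷ _ = h

    node-≤ : ∀ {c v p} → c < k → Node F (suc c) (v ∷ p) → v ≤ d + suc c
    node-≤ {v = v} c<k nd = subst (λ z → v ≤ d + z) (length-node nd) (hd≤ (node-Valid c<k nd))

    node-Compat : ∀ {r s} → r ≤ k → Node F r s → Compat F s
    node-Compat {zero}  r≤k (x , x∈F , refl) = tt
    node-Compat {suc r} r≤k nd@(x , x∈F , refl) = node-Compat (<⇒≤ r≤k) (x , x∈F , refl) ,
      λ nd′ → no-cross r≤k nd (node-subst nd′) , no-cross r≤k (node-subst nd′) nd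
      where
      node-subst : ∀ {t} → Node F (suc (length (pre x r))) t → Node F (suc r) t
      node-subst {t} = subst (λ z → Node F (suc z) t) (length-pre x r)

    M-node : ∀ {r p} → r < k → Node F r p → Node F (suc r) (M F p ∷ p)
    M-node {r} {p} r<k nd@(x , x∈F , e) with M-attained F p
    ... | inj₂ nd′ = subst (λ z → Node F (suc z) (M F p ∷ p)) (length-node nd) nd′
    ... | inj₁ z = ⊥-elim (<⇒≱ (≤-<-trans z≤n (at-step (face-InV x∈F) r<k))
                     (subst (at x (suc r) ≤_) z (M-upper (x , x∈F , cong (at x (suc r) ∷_) e))))

    M≤n : ∀ {p} → length p < k → M F p ≤ n
    M≤n {p} l = M-bounded {F} {p} (λ where (x , x∈F , e) → subst (_≤ n) (∷-injectiveˡ e) (at≤n (face-InV x∈F) l))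

  -- The next entry u is the end of the shortest arc covering the new point from the left.
  next-entry : ∀ {F s} → IsFace k n F → length s < k → Valid d s →
    ∃ λ u → (hd s < u × u ≤ d + suc (length s)) ×
      (∀ {w q} → Node F (suc (length s)) (w ∷ q) → ¬ Bad s u q w × ¬ Bad q w s u)
  next-entry {F} {s} face c<k val with any? Q? F
    where
    Q? : ∀ x → Dec (Lex< (pre x (length s)) s × hd s < at x (suc (length s)))
    Q? x = Lex<? _ _ ×-dec (hd s <? _)
  -- Without a covering arc the largest admissible entry works, as no arc ends further to the right.
  ... | no none = d + suc (length s) , (≤-<-trans (hd≤ val) (+-monoʳ-< d ≤-refl) , ≤-refl) , λ nd →
          (λ (_ , _ , lt) → <⇒≱ lt (node-≤ face c<k nd)) , λ { (l , h , _) → absurd nd l h }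
    where
    absurd : ∀ {w q} → Node F (suc (length s)) (w ∷ q) → Lex< q s → hd s < w → ⊥
    absurd (y , y∈F , refl) l h = none (lose y∈F (l , h))
  ... | yes some with maximal (λ x y → at y (suc (length s)) < at x (suc (length s))) (λ x y → _ <? _)
                      (λ a b → <-trans b a) (<-irrefl refl)
                      (λ x → Lex<? (pre x (length s)) s ×-dec (hd s <? at x (suc (length s)))) F some
  ...   | x , x∈F , (l , h) , mn = at x (suc (length s)) , (h , at-upper (face-InV face x∈F) c<k) , λ nd →
          (λ (l′ , h′ , lt) → no-cross face c<k (x , x∈F , refl) nd (Lex<-trans l l′ , h′ , lt)) ,
          λ { (l′ , h′ , lt) → least nd l′ h′ lt }
    where
    least : ∀ {w q} → Node F (suc (length s)) (w ∷ q) → Lex< q s → hd s < w → ¬ w < at x (suc (length s))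
    least (y , y∈F , refl) l′ h′ = mn y y∈F (l′ , h′)

  Compat-pre : ∀ {F} x {c r} → c ≤ r → Compat F (pre x r) → Compat F (pre x c)
  Compat-pre x {c} {r} c≤r C with m≤n⇒m<n∨m≡n c≤r
  ... | inj₂ refl = C
  Compat-pre x {c} {suc r} c≤r (C , _) | inj₁ (s≤s c≤r′) = Compat-pre x c≤r′ C

  Compat⇒NoncrossingWith : ∀ {F x} → IsFace k n F → InV k n x → Compat F (pre x k) → NoncrossingWith F x
  Compat⇒NoncrossingWith {F} {x} face X C {y} y∈F =
    NoBad⇒noncrossing X Y (λ c c<k → proj₁ (nb c c<k)) (λ c c<k → proj₂ (nb c c<k)) ,
    NoBad⇒noncrossing Y X (λ c c<k → proj₂ (nb c c<k)) (λ c c<k → proj₁ (nb c c<k))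
    where
    Y : InV k n y
    Y = face-InV face y∈F
    nb : ∀ c → c < k → ¬ Bad (pre x c) (at x (suc c)) (pre y c) (at y (suc c)) ×
                       ¬ Bad (pre y c) (at y (suc c)) (pre x c) (at x (suc c))
    nb c c<k = proj₂ (Compat-pre x c<k C) (y , y∈F , cong (λ z → pre y (suc z)) (length-pre x c))

  -- `next-entry` always supplies a compatible entry, so the prefix can be prolonged greedily; `m`
  -- counts the missing entries.
  complete : ∀ {F} → IsFace k n F → ∀ m s → length s + m ≡ k → Valid d s → Compat F s →
    ∃ λ x → InV k n x × pre x (length s) ≡ s × NoncrossingWith F x
  complete face zero s e val C =
    reverse s , X , pre-reverse s ,
    Compat⇒NoncrossingWith face X (subst (Compat _) (sym (trans (cong (pre (reverse s)) (sym len)) (pre-reverse s))) C)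
    where
    len : length s ≡ k
    len = trans (sym (+-identityʳ _)) e
    X = reverse-InV val len
  complete face (suc m) s e val C with next-entry {s = s} face (subst (length s <_) e (m<m+n _ (s≤s z≤n))) val
  ... | u , bounds , nb with complete face m (u ∷ s) (trans (sym (+-suc _ m)) e) (bounds ∷ val) (C , nb)
  ...   | x , X , e′ , nc = x , X , ∷-injectiveʳ e′ , nc

  -- The levels of `p` are compatible because `p` comes from a column of `F`; only the new arc has
  -- to be tested.
  complete-node : ∀ {F r v p} → IsFace k n F → r < k → Node F r p → hd p < v → v ≤ d + suc r →
    (∀ {w q} → Node F (suc r) (w ∷ q) → ¬ Bad p v q w × ¬ Bad q w p v) →
    ∃ λ x → InV k n x × pre x (suc r) ≡ v ∷ p × NoncrossingWith F x
  complete-node {r = r} face r<k nd h b nb with length-node nd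
  ... | refl = complete face (k ∸ suc r) (_ ∷ _) (m+[n∸m]≡n r<k)
                 ((h , b) ∷ node-Valid face (<⇒≤ r<k) nd) (node-Compat face (<⇒≤ r<k) nd , nb)

  face-∷ : ∀ {F x} → IsFace k n F → InV k n x → x ∉ F → NoncrossingWith F x → IsFace k n (x ∷ F)
  face-∷ {F} {x} (unique , cols , ncs) X x∉F nc = All.¬Any⇒All¬ _ x∉F ∷ unique , X ∷ cols , ncs′
    where
    ncs′ : ∀ I J → I ∈ x ∷ F → J ∈ x ∷ F → Noncrossing k I J
    ncs′ I J (here refl) (here refl) = Noncrossing-refl x
    ncs′ I J (here refl) (there m)   = proj₁ (nc m)
    ncs′ I J (there m)   (here refl) = proj₂ (nc m)
    ncs′ I J (there m)   (there m′)  = ncs I J m m′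

  max-∈ : ∀ {H x} → MaxFace k n H → InV k n x → NoncrossingWith H x → x ∈ H
  max-∈ {H} {x} (face , mx) X nc with x ∈? H
  ... | yes m = m
  ... | no  m = mx (x ∷ H) (face-∷ face X m nc) there (here refl)

  -- The arc completes to a column noncrossing with `H`, and maximality puts that column into `H`.
  -- So each level is a maximal noncrossing graph over the level before it.
  level-max : ∀ {H r v p} → MaxFace k n H → r < k → Node H r p → hd p < v → v ≤ d + suc r →
    (∀ {w q} → Node H (suc r) (w ∷ q) → ¬ Bad p v q w × ¬ Bad q w p v) → Node H (suc r) (v ∷ p)
  level-max mx r<k nd h b nb with complete-node (proj₁ mx) r<k nd h b nb
  ... | x , X , e , nc = x , max-∈ mx X nc , e

  root-node : ∀ {H} → MaxFace k n H → Node H 0 []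
  root-node mx with complete (proj₁ mx) k [] refl [] tt
  ... | x , X , e , nc = x , max-∈ mx X nc , e

  -- The list of prefixes and the key of a face.

  prefixes : List (List ℕ)
  prefixes = concatMap (words n) (upTo k)

  prefixes-sorted : AllPairs _≺_ prefixes
  prefixes-sorted = AllPairs.concat⁺
    (All.map⁺ (All.tabulate (λ {r} _ → level r)))
    (AllPairs.map⁺ (AllPairs.applyUpTo⁺₁ id k (λ {i} {j} i<j _ →
      All.tabulate (λ m → All.tabulate (λ m′ → inj₁ (subst₂ _<_ (sym (∈-words⁻ i m)) (sym (∈-words⁻ j m′)) i<j))))))
    where
    strengthen : ∀ {r} ps → (∀ {p} → p ∈ ps → length p ≡ r) → AllPairs (λ p q → Lex< q p) ps → AllPairs _≺_ ps
    strengthen []       _ []       = []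
    strengthen (p ∷ ps) l (o ∷ os) =
      All.tabulate (λ m → inj₂ (trans (l (here refl)) (sym (l (there m))) , All.lookup o m)) ∷ strengthen ps (l ∘ there) os
    level : ∀ r → AllPairs _≺_ (words n r)
    level r = strengthen (words n r) (∈-words⁻ r) (words-descending n r)

  ∈-prefixes⁻ : ∀ {p} → p ∈ prefixes → length p < k
  ∈-prefixes⁻ m with find (∈-concatMap⁻ (words n) {xs = upTo k} m)
  ... | r , r∈ , m′ = subst (_< k) (sym (∈-words⁻ r m′)) (∈-upTo⁻ r∈)

  Valid-≤n : ∀ {s} → length s ≤ k → Valid d s → All (_≤ n) s
  Valid-≤n {s} l val = All.map (λ (_ , b) → ≤-trans b (subst (d + length s ≤_) d+k (+-monoʳ-≤ d l))) (Valid-All val)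

  node-∈-prefixes : ∀ {F r p} → IsFace k n F → r < k → Node F r p → p ∈ prefixes
  node-∈-prefixes face r<k nd with length-node nd
  ... | refl = ∈-concatMap⁺ (words n) (lose (∈-upTo⁺ r<k) (∈-words⁺ (Valid-≤n (<⇒≤ r<k) (node-Valid face (<⇒≤ r<k) nd))))

  key : Face → ℕ
  key F = number n (M F) prefixes

  key-<⁺ : ∀ {F G p} → IsFace k n F → p ∈ prefixes →
    (∀ {q} → q ≺ p → M F q ≤ M G q) → M F p < M G p → key F < key G
  key-<⁺ {F} face m le lt = number-<⁺ n prefixes prefixes-sorted (λ m → M≤n face (∈-prefixes⁻ m)) m (λ _ → le) lt

  key-<⁻ : ∀ {F G} → IsFace k n G → key F < key G →
    ∃ λ p → p ∈ prefixes × M F p < M G p × (∀ {q} → q ∈ prefixes → q ≺ p → M F q ≡ M G q)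
  key-<⁻ face lt = number-<⁻ n prefixes prefixes-sorted (λ m → M≤n face (∈-prefixes⁻ m)) lt

  key-≋ : ∀ {F G} → F ≋ G → key F ≡ key G
  key-≋ (F⊆G , G⊆F) = number-cong n prefixes (λ p → ≤-antisym (M-mono p F⊆G) (M-mono p G⊆F))

  -- Nodes of maximal faces

  -- An arc (p , v) of `G` is compatible with `H`. If (q , w) in `H` crossed it with p < q, then (q
  -- , M q) would cross it in `G`, as w is at most M q. If q < p, then (q , w) would cross (p , M p)
  -- in `H`.
  next-level : ∀ {G H r s} → IsFace k n G → MaxFace k n H → r < k →
    (∀ {t} → Node G r t → Node H r t) → (∀ {t} → Node H r t → Node G r t) →
    (∀ {q} → Node H r q → M G q ≡ M H q) → Node G (suc r) s → Node H (suc r) s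
  next-level {G} {H} {r} {[]} fG mH r<k to from eq (x , _ , ())
  next-level {G} {H} {r} {v ∷ p} fG mH@(fH , _) r<k to from eq nd =
    level-max mH r<k ndH (node-< fG r<k nd) (node-≤ fG r<k nd) λ {w} {q} nd′ →
      (λ (l , h , lt) → <⇒≱ lt (≤-trans (M-upper nd′) (q-bound nd′ l h))) ,
      λ (l , h , lt) → no-cross fH r<k nd′ (M-node fH r<k ndH)
        (l , h , <-≤-trans lt (subst (v ≤_) (eq ndH) (M-upper nd)))
    where
    ndH : Node H r p
    ndH = to (Node-tail nd)
    q-bound : ∀ {w q} → Node H (suc r) (w ∷ q) → Lex< p q → hd q < v → M H q ≤ v
    q-bound {w} {q} nd′ l h = subst (_≤ v) (eq (Node-tail nd′))
      (≮⇒≥ (λ lt → no-cross fG r<k nd (M-node fG r<k (from (Node-tail nd′))) (l , h , lt)))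

  same-nodes : ∀ {G H} a → MaxFace k n G → MaxFace k n H → a ≤ k →
    (∀ {q} → q ∈ prefixes → length q < a → M G q ≡ M H q) →
    (∀ {s} → Node G a s → Node H a s) × (∀ {s} → Node H a s → Node G a s)
  same-nodes zero mG mH a≤k eq =
    (λ { (x , _ , refl) → root-node mH }) , (λ { (x , _ , refl) → root-node mG })
  same-nodes {G} {H} (suc a) mG@(fG , _) mH@(fH , _) a<k eq with same-nodes a mG mH (<⇒≤ a<k) (λ m l → eq m (m≤n⇒m≤1+n l))
  ... | to , from = next-level fG mH a<k to from eqH , next-level fH mG a<k from to (λ nd → sym (eqH (to nd)))
    where
    eqH : ∀ {q} → Node H a q → M G q ≡ M H q
    eqH nd = eq (node-∈-prefixes fH a<k nd) (≤-reflexive (cong suc (length-node nd)))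

  first-least : ∀ {H r q} → IsFace k n H → r ≤ k → Node H r q → ¬ Lex< q (first r)
  first-least face r≤k nd with length-node nd
  ... | refl = first-min (node-Valid face r≤k nd)

  -- No prefix is smaller than (1,...,r), and a larger one has a last entry above r, too large for a
  -- crossing.
  first-node : ∀ {H} r → MaxFace k n H → r ≤ k → Node H r (first r)
  first-node zero    mH r≤k = root-node mH
  first-node (suc r) mH@(fH , _) r<k =
    level-max mH r<k (first-node r mH (<⇒≤ r<k)) (subst (_< suc r) (sym (hd-first r)) ≤-refl) (m≤n+m _ d) λ nd →
      (λ (l , h , _) → collapse (Node-tail nd) l (≤-pred h)) ,
      (λ (l , _ , _) → first-least fH (<⇒≤ r<k) (Node-tail nd) l)
    where
    collapse : ∀ {q} → Node _ r q → Lex< (first r) q → hd q ≤ r → ⊥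
    collapse nd l h with length-node nd
    ... | refl = Lex<-irrefl (subst (Lex< _) (hd≤length⇒first (node-Valid fH (<⇒≤ r<k) nd) h) l)

  -- Nothing crosses this arc: its end is the largest possible one, and no prefix lies to its left.
  first-last-node : ∀ {H r} → MaxFace k n H → r < k → Node H (suc r) (d + suc r ∷ first r)
  first-last-node {H} {r} mH@(fH , _) r<k =
    level-max mH r<k (first-node r mH (<⇒≤ r<k))
      (subst (_< d + suc r) (sym (hd-first r)) (m≤n+m (suc r) d)) ≤-refl λ nd →
      (λ (_ , _ , lt) → <⇒≱ lt (node-≤ fH r<k nd)) ,
      (λ (l , _ , _) → first-least fH (<⇒≤ r<k) (Node-tail nd) l)

  M-first : ∀ {H r} → MaxFace k n H → r < k → d + suc r ≤ M H (first r)
  M-first mH r<k = M-upper (first-last-node mH r<k)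

  first-< : ∀ {H r q} → IsFace k n H → r ≤ k → Node H r q → q ≢ first r → Lex< (first r) q
  first-< {r = r} {q} fH r≤k nd ne with Lex<-cmp (first r) q
  ... | inj₁ l          = l
  ... | inj₂ (inj₁ e)   = ⊥-elim (ne (sym e))
  ... | inj₂ (inj₂ g)   = ⊥-elim (first-least fH r≤k nd g)

  -- The shortest arc that strictly covers (q , M H q) from the left ends at M H q, since otherwise
  -- its right end could be joined to q.
  left-neighbour : ∀ {H r q} → MaxFace k n H → r < k → Node H r q → q ≢ first r →
    ∃ λ p → Lex< p q × Node H (suc r) (M H q ∷ p)
  -- The longest arc, from (1,...,r), makes the search for a cover nonempty.
  left-neighbour {H} {r} {q} mH@(fH , _) r<k nd ne with first-last-node mH r<k
  ... | z , z∈H , ez with maximal (λ x y → at y (suc r) < at x (suc r)) (λ x y → _ <? _)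
        (λ a b → <-trans b a) (<-irrefl refl)
        (λ x → Lex<? (pre x r) q ×-dec (M H q ≤? at x (suc r))) H
        (lose z∈H (subst (λ s → Lex< s q) (sym (∷-injectiveʳ ez)) (first-< fH (<⇒≤ r<k) nd ne) ,
                   subst (M H q ≤_) (sym (∷-injectiveˡ ez)) (node-≤ fH r<k (M-node fH r<k nd))))
  ... | x , x∈H , (l , M≤) , mn with m≤n⇒m<n∨m≡n M≤
  ...   | inj₂ e = pre x r , l , (x , x∈H , cong (_∷ pre x r) (sym e))
  ...   | inj₁ M< = ⊥-elim (<⇒≱ M< (M-upper joined))
    where
    covered : ∀ {w t} → Node H (suc r) (w ∷ t) → ¬ Bad t w q (at x (suc r))
    covered nd′@(y , y∈H , refl) (l′ , h , lt) with M H q ≤? at y (suc r)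
    ... | yes le = mn y y∈H (l′ , le) lt
    ... | no  gt = no-cross fH r<k nd′ (M-node fH r<k nd) (l′ , h , ≰⇒> gt)
    joined : Node H (suc r) (at x (suc r) ∷ q)
    joined = level-max mH r<k nd (<-trans (node-< fH r<k (M-node fH r<k nd)) M<) (node-≤ fH r<k (x , x∈H , refl))
      λ nd′ → (λ (l′ , h , lt) → no-cross fH r<k (x , x∈H , refl) nd′ (Lex<-trans l l′ , h , lt)) , covered nd′

  -- Flipping (q , w) gives (p , u) for the nearest such p and u.
  Flippable : Face → ℕ → ℕ → List ℕ → Set
  Flippable H r w q =
    (∃ λ p → Lex< p q × Node H (suc r) (w ∷ p)) × (∃ λ u → u < w × Node H (suc r) (u ∷ q))

  -- The arc is (q , M H q) at the first prefix q where the brackets differ. Its left neighbour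
  -- always exists, and M G q turns out to be a lower entry at q in `H` too.
  flippable-difference : ∀ {G H} → MaxFace k n G → MaxFace k n H → key G < key H →
    ∃ λ r → ∃ λ w → ∃ λ q → r < k × Node H (suc r) (w ∷ q) × ¬ Node G (suc r) (w ∷ q) × Flippable H r w q
  flippable-difference {G} {H} mG@(fG , _) mH@(fH , _) lt with key-<⁻ {G} {H} fH lt
  ... | q , q∈ , v<w , eq with M-attained H q
  ...   | inj₁ z = ⊥-elim (<⇒≱ (≤-<-trans z≤n v<w) (≤-reflexive z))
  ...   | inj₂ ndw = r , w , q , r<k , ndw , (λ nd → <⇒≱ v<w (M-upper nd)) ,
                     left-neighbour mH r<k (Node-tail ndw) q≢first , v , v<w , ndv
    where
    r w v : ℕ
    r = length q
    w = M H q
    v = M G q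
    r<k : r < k
    r<k = ∈-prefixes⁻ q∈
    same : (∀ {s} → Node G r s → Node H r s) × (∀ {s} → Node H r s → Node G r s)
    same = same-nodes r mG mH (<⇒≤ r<k) (λ m l → eq m (inj₁ l))
    ndv-G : Node G (suc r) (v ∷ q)
    ndv-G = M-node fG r<k (proj₂ same (Node-tail ndw))
    q≢first : q ≢ first r
    q≢first e = <⇒≱ v<w (≤-trans (node-≤ fH r<k ndw) (subst (λ z → d + suc r ≤ M G z) (sym e) (M-first mG r<k)))
    -- If (t , y) in `H` crossed (q , v) with q < t, then t precedes q, the brackets agree at t, and
    -- (t , M t) would cross (q , v) in `G`. If t < q, then (t , y) would cross (q , w) in `H`.
    ndv : Node H (suc r) (v ∷ q)
    ndv = level-max mH r<k (Node-tail ndw) (node-< fG r<k ndv-G) (node-≤ fG r<k ndv-G) λ {y} {t} nd →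
      (λ (l , h , lt′) →
        let nt = Node-tail nd
            et = eq (node-∈-prefixes fH r<k nt) (inj₂ (length-node nt , l))
        in no-cross fG r<k ndv-G (M-node fG r<k (proj₂ same nt))
             (l , h , <-≤-trans lt′ (subst (y ≤_) (sym et) (M-upper nd)))) ,
      (λ (l , h , lt′) → no-cross fH r<k nd ndw (l , h , <-trans lt′ v<w))

  Flippable⇒≢first : ∀ {H r w q} → IsFace k n H → r < k → Flippable H r w q → q ≢ first r
  Flippable⇒≢first fH r<k ((p , l , nd) , _) refl = first-least fH (<⇒≤ r<k) (Node-tail nd) l

  ≢first-extend : ∀ {x c r} → c ≤ r → pre x c ≢ first c → pre x r ≢ first r
  ≢first-extend {c = c} {r} c≤r ne e with m≤n⇒m<n∨m≡n c≤r
  ... | inj₂ refl = ne e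
  ≢first-extend {c = c} {suc r} c≤r ne e | inj₁ (s≤s c≤r′) = ≢first-extend c≤r′ ne (∷-injectiveʳ e)

  -- A flip removes one column, so that column must be the only one through its arc. If another
  -- column shares the arc, the two branch at a later level c, where the arc to the largest entry is
  -- again flippable. The fuel `m` bounds the levels left.
  flippable-column : ∀ {H} m {r x} → MaxFace k n H → r < k → k ∸ r ≤ m → x ∈ H → Flippable H r (at x (suc r)) (pre x r) →
    ∃ λ c → ∃ λ y → r ≤ c × c < k × y ∈ H × pre y (suc r) ≡ pre x (suc r) ×
      Flippable H c (at y (suc c)) (pre y c) × (∀ {z} → z ∈ H → pre z (suc c) ≡ pre y (suc c) → z ≡ y)
  flippable-column zero mH r<k le x∈H fl = ⊥-elim (<⇒≱ r<k (m∸n≡0⇒m≤n (n≤0⇒n≡0 le)))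
  flippable-column {H} (suc m) {r} {x} mH@(fH , _) r<k le x∈H fl
    with any? (λ z → (pre z (suc r) ≟ᵛ pre x (suc r)) ×-dec ¬? (z ≟ᵛ x)) H
  ... | no none = r , x , ≤-refl , r<k , x∈H , refl , fl , unique
    where
    unique : ∀ {z} → z ∈ H → pre z (suc r) ≡ pre x (suc r) → z ≡ x
    unique {z} z∈H e with z ≟ᵛ x
    ... | yes z≡x = z≡x
    ... | no  z≢x = ⊥-elim (none (lose z∈H (e , z≢x)))
  ... | yes some with find some
  ...   | z , z∈H , e , z≢x with pre-difference (suc r) r<k (proj₁ (face-InV fH z∈H)) (proj₁ (face-InV fH x∈H)) z≢x e
  ...     | c , r<c , c<k , ec , ne with M-node fH c<k (x , x∈H , refl)
  ...       | y , y∈H , ey with flippable-column m {c} {y} mH c<k (≤-pred (≤-trans (∸-monoʳ-< r<c (<⇒≤ c<k)) le)) y∈H fl′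
    where
    -- The two columns have different next entries here, so one of these is below the maximum.
    lower : ∃ λ u → u < M H (pre x c) × Node H (suc c) (u ∷ pre x c)
    lower with m≤n⇒m<n∨m≡n (M-upper {H} {c} (x , x∈H , refl)) | m≤n⇒m<n∨m≡n (M-upper {H} {c} (z , z∈H , cong (_ ∷_) ec))
    ... | inj₁ lt | _       = at x (suc c) , lt , (x , x∈H , refl)
    ... | inj₂ _  | inj₁ lt = at z (suc c) , lt , (z , z∈H , cong (_ ∷_) ec)
    ... | inj₂ a  | inj₂ b  = ⊥-elim (ne (trans b (sym a)))
    fl′ : Flippable H c (at y (suc c)) (pre y c)
    fl′ = subst₂ (Flippable H c) (sym (∷-injectiveˡ ey)) (sym (∷-injectiveʳ ey))
      (left-neighbour mH c<k (x , x∈H , refl)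
        (≢first-extend {x} (<⇒≤ r<c) (Flippable⇒≢first fH r<k fl)) , lower)
  ...         | c′ , y′ , c≤c′ , c′<k , y′∈H , ey′ , rest =
    c′ , y′ , ≤-trans (<⇒≤ r<c) c≤c′ , c′<k , y′∈H ,
    trans (pre-≤ {y′} {y} (≤-trans r<c (n≤1+n _)) ey′) (pre-≤ {y} {x} r<c (∷-injectiveʳ ey)) , rest

  -- Enumeration of the maximal faces

  InV? : ∀ x → Dec (InV k n x)
  InV? x = (length x ≟ k) ×-dec (Linked.linked? _<?_ x ×-dec all? (λ v → (1 ≤? v) ×-dec (v ≤? n)) x)

  vectors : List Vect
  vectors = filter InV? (words n k)

  ∈-vectors : ∀ {x} → InV k n x → x ∈ vectors
  ∈-vectors {x} X@(refl , _ , bounds) = ∈-filter⁺ InV? (∈-words⁺ (All.map proj₂ bounds)) X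

  vectors-InV : ∀ {x} → x ∈ vectors → InV k n x
  vectors-InV m = proj₂ (∈-filter⁻ InV? {xs = words n k} m)

  vectors-unique : Unique vectors
  vectors-unique = Unique.filter⁺ InV? (AllPairs.map (λ { l refl → Lex<-irrefl l }) (words-descending n k))

  Noncrossing-sym : ∀ x y → Noncrossing k x y → Noncrossing k y x
  Noncrossing-sym x y nc a b 1≤a a<b b≤k eq (inj₁ c) = nc a b 1≤a a<b b≤k (λ l p q → sym (eq l p q)) (inj₂ c)
  Noncrossing-sym x y nc a b 1≤a a<b b≤k eq (inj₂ c) = nc a b 1≤a a<b b≤k (λ l p q → sym (eq l p q)) (inj₁ c)

  NoBad? : ∀ x y → Dec (NoBad x y)
  NoBad? x y = map′ (λ h c l → h {c} l) (λ h {c} l → h c l)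
    (allUpTo? (λ c → ¬? (Lex<? (pre x c) (pre y c) ×-dec ((hd (pre y c) <? at x (suc c)) ×-dec (at x (suc c) <? at y (suc c))))) k)

  -- `NoBad` is a bounded quantification over levels, hence decidable.
  noncrossing? : ∀ {x y} → InV k n x → InV k n y → Dec (Noncrossing k x y)
  noncrossing? {x} {y} X Y = map′ (λ (a , b) → NoBad⇒noncrossing X Y a b)
    (λ nc → noncrossing⇒NoBad X Y nc , noncrossing⇒NoBad Y X (Noncrossing-sym x y nc)) (NoBad? x y ×-dec NoBad? y x)

  NoncrossingWith? : ∀ {F x} → IsFace k n F → InV k n x → Dec (NoncrossingWith F x)
  NoncrossingWith? {F} {x} (_ , cols , _) X = map′ (λ a {y} m → All.lookup a m , Noncrossing-sym x y (All.lookup a m))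
    (λ nc → All.tabulate (proj₁ ∘ nc)) (go cols)
    where
    go : ∀ {F} → All (InV k n) F → Dec (All (Noncrossing k x) F)
    go []       = yes []
    go (Y ∷ Ys) = map′ (λ (a , b) → a ∷ b) (λ { (a ∷ b) → a , b }) (noncrossing? X Y ×-dec go Ys)

  face-tail : ∀ {F x} → IsFace k n (x ∷ F) → IsFace k n F
  face-tail (_ ∷ unique , _ ∷ cols , nc) = unique , cols , λ I J m m′ → nc I J (there m) (there m′)

  isFace? : ∀ F → Dec (IsFace k n F)
  isFace? [] = yes ([] , [] , λ _ _ ())
  isFace? (x ∷ F) with isFace? F | InV? x | x ∈? F
  ... | no ¬f | _     | _      = no (¬f ∘ face-tail)
  ... | yes _ | no ¬X | _      = no (λ { (_ , X ∷ _ , _) → ¬X X })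
  ... | yes _ | yes _ | yes m  = no (λ { (x∉ ∷ _ , _) → All.All¬⇒¬Any x∉ m })
  ... | yes f | yes X | no x∉F with NoncrossingWith? f X
  ...   | yes nc = yes (face-∷ f X x∉F nc)
  ...   | no ¬nc = no (λ { (_ , _ , nc) → ¬nc (λ m → nc _ _ (here refl) (there m) , nc _ _ (there m) (here refl)) })

  -- The vectors are tried in turn. A rejected one crosses the current face, hence every larger
  -- face.
  saturate : ∀ {F} vs → All (InV k n) vs → IsFace k n F →
    ∃ λ G → IsFace k n G × F ⊆ G × (∀ {x} → x ∈ vs → NoncrossingWith G x → x ∈ G)
  saturate {F} [] _ f = F , f , id , λ ()
  saturate {F} (v ∷ vs) (V ∷ Vs) f with v ∈? F | NoncrossingWith? f V
  ... | yes m | _ with saturate vs Vs f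
  ...   | G , g , F⊆G , sat = G , g , F⊆G , λ where
    (here refl) _  → F⊆G m
    (there m′)  nc → sat m′ nc
  saturate {F} (v ∷ vs) (V ∷ Vs) f | no v∉F | yes nc with saturate vs Vs (face-∷ f V v∉F nc)
  ...   | G , g , F⊆G , sat = G , g , F⊆G ∘ there , λ where
    (here refl) _  → F⊆G (here refl)
    (there m′)  nc → sat m′ nc
  saturate {F} (v ∷ vs) (V ∷ Vs) f | no v∉F | no ¬nc with saturate vs Vs f
  ...   | G , g , F⊆G , sat = G , g , F⊆G , λ where
    (here refl) nc → ⊥-elim (¬nc (λ m → nc (F⊆G m)))
    (there m′)  nc → sat m′ nc

  extend : ∀ {F} → IsFace k n F → ∃ λ G → MaxFace k n G × F ⊆ G
  extend f with saturate vectors (All.tabulate vectors-InV) f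
  ... | G , g , F⊆G , sat = G , (g , λ G′ g′ G⊆G′ m → sat (∈-vectors (face-InV g′ m))
          (λ m′ → proj₂ (proj₂ g′) _ _ m (G⊆G′ m′) , proj₂ (proj₂ g′) _ _ (G⊆G′ m′) m)) , F⊆G

  candidate : Face → List Face
  candidate F with isFace? F
  ... | yes f = proj₁ (extend f) ∷ []
  ... | no _  = []

  candidate-max : ∀ F → All (MaxFace k n) (candidate F)
  candidate-max F with isFace? F
  ... | yes f = proj₁ (proj₂ (extend f)) ∷ []
  ... | no _  = []

  ∈-candidate : ∀ {F} → IsFace k n F → ∃ λ G → G ∈ candidate F × F ⊆ G
  ∈-candidate {F} f with isFace? F
  ... | yes f′ = proj₁ (extend f′) , here refl , proj₂ (proj₂ (extend f′))
  ... | no ¬f  = ⊥-elim (¬f f)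

  candidates : List Face
  candidates = concatMap candidate (subsets vectors)

  candidates-max : All (MaxFace k n) candidates
  candidates-max = All.concat⁺ (All.map⁺ {xs = subsets vectors} (All.tabulate (λ {F} _ → candidate-max F)))

  max-unique : ∀ {G H} → MaxFace k n G → IsFace k n H → G ⊆ H → G ≋ H
  max-unique (_ , mx) h G⊆H = G⊆H , mx _ h G⊆H

  -- The elements of `G`, in the order of `vectors`, form a sublist whose extension has the same
  -- elements, since `G` is maximal.
  candidates-complete : ∀ {G} → MaxFace k n G → ∃ λ H → H ∈ candidates × G ≋ H
  candidates-complete {G} mG@(g , mx) = complete-with (∈-candidate face)
    where
    F : Face
    F = filter (_∈? G) vectors
    F⊆G : F ⊆ G
    F⊆G m = proj₂ (∈-filter⁻ (_∈? G) {xs = vectors} m)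
    G⊆F : G ⊆ F
    G⊆F m = ∈-filter⁺ (_∈? G) (∈-vectors (face-InV g m)) m
    face : IsFace k n F
    face = Unique.filter⁺ (_∈? G) vectors-unique , All.tabulate (λ m → face-InV g (F⊆G m)) ,
           λ I J m m′ → proj₂ (proj₂ g) I J (F⊆G m) (F⊆G m′)
    complete-with : (∃ λ H → H ∈ candidate F × F ⊆ H) → ∃ λ H → H ∈ candidates × G ≋ H
    complete-with (H , m , F⊆H) = H , ∈-concatMap⁺ candidate (lose (filter-∈-subsets (_∈? G) vectors) m) ,
      max-unique mG (proj₁ (All.lookup (candidate-max F) m)) (F⊆H ∘ G⊆F)

  -- Equal digits mean equal brackets at all prefixes, hence the same nodes of length k, and these
  -- are the columns.
  key-injective : ∀ {G H} → MaxFace k n G → MaxFace k n H → key G ≡ key H → G ≋ H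
  key-injective {G} {H} mG@(g , _) mH@(h , _) e = max-unique mG h G⊆H
    where
    M-eq : ∀ {q} → q ∈ prefixes → M G q ≡ M H q
    M-eq = number-≡⁻ n prefixes (λ m → M≤n g (∈-prefixes⁻ m)) (λ m → M≤n h (∈-prefixes⁻ m)) e
    G⊆H : G ⊆ H
    G⊆H {x} m with proj₁ (same-nodes k mG mH ≤-refl (λ q∈ _ → M-eq q∈)) (x , m , refl)
    ... | y , m′ , e′ = subst (_∈ H) (pre-injective (proj₁ (face-InV h m′)) (proj₁ (face-InV g m)) e′) m′

  -- Flips

  -- By `unique`, dropping `x` also drops its arc (q , w), which makes room for the arc (p , u).
  module Flip {H r x} (mH : MaxFace k n H) (r<k : r < k) (x∈H : x ∈ H)
    (fl : Flippable H r (at x (suc r)) (pre x r))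
    (unique : ∀ {z} → z ∈ H → pre z (suc r) ≡ pre x (suc r) → z ≡ x) where

    private
      fH : IsFace k n H
      fH = proj₁ mH

      w : ℕ
      w = at x (suc r)

      q : List ℕ
      q = pre x r

      x-node : Node H (suc r) (w ∷ q)
      x-node = x , x∈H , refl

      nearest-left : ∃ λ a → a ∈ H × (Lex< (pre a r) q × at a (suc r) ≡ w) ×
        (∀ y → y ∈ H → Lex< (pre y r) q × at y (suc r) ≡ w → ¬ Lex< (pre a r) (pre y r))
      nearest-left with proj₁ fl
      ... | p , l , (a , a∈H , e) = maximal (λ a b → Lex< (pre a r) (pre b r)) (λ _ _ → Lex<? _ _) Lex<-trans Lex<-irrefl
              (λ y → Lex<? (pre y r) q ×-dec (at y (suc r) ≟ w)) H
              (lose a∈H (subst (λ z → Lex< z q) (sym (∷-injectiveʳ e)) l , ∷-injectiveˡ e))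

      nearest-below : ∃ λ b → b ∈ H × (pre b r ≡ q × at b (suc r) < w) ×
        (∀ y → y ∈ H → pre y r ≡ q × at y (suc r) < w → ¬ at b (suc r) < at y (suc r))
      nearest-below with proj₂ fl
      ... | u , u<w , (b , b∈H , e) = maximal (λ a b → at a (suc r) < at b (suc r)) (λ _ _ → _ <? _) <-trans (<-irrefl refl)
              (λ y → (pre y r ≟ᵛ q) ×-dec (at y (suc r) <? w)) H
              (lose b∈H (∷-injectiveʳ e , subst (_< w) (sym (∷-injectiveˡ e)) u<w))

    module Step {a b} (a∈H : a ∈ H) (p<q : Lex< (pre a r) q) (aw : at a (suc r) ≡ w)
      (a-nearest : ∀ y → y ∈ H → Lex< (pre y r) q × at y (suc r) ≡ w → ¬ Lex< (pre a r) (pre y r))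
      (b∈H : b ∈ H) (bq : pre b r ≡ q) (u<w : at b (suc r) < w)
      (b-nearest : ∀ y → y ∈ H → pre y r ≡ q × at y (suc r) < w → ¬ at b (suc r) < at y (suc r)) where

      p : List ℕ
      p = pre a r

      u : ℕ
      u = at b (suc r)

      a-node : Node H (suc r) (w ∷ p)
      a-node = a , a∈H , cong (_∷ p) aw

      b-node : Node H (suc r) (u ∷ q)
      b-node = b , b∈H , cong (u ∷_) bq

      hd-q<u : hd q < u
      hd-q<u = node-< fH r<k b-node

      a≢x : a ≢ x
      a≢x refl = Lex<-irrefl p<q

      b≢x : b ≢ x
      b≢x refl = <-irrefl refl u<w

      F : Face
      F = filter (λ y → ¬? (y ≟ᵛ x)) H

      F⊆H : F ⊆ H
      F⊆H m = proj₁ (∈-filter⁻ (λ y → ¬? (y ≟ᵛ x)) {xs = H} m)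

      F∌x : x ∉ F
      F∌x m = proj₂ (∈-filter⁻ (λ y → ¬? (y ≟ᵛ x)) {xs = H} m) refl

      ∈-F : ∀ {y} → y ∈ H → y ≢ x → y ∈ F
      ∈-F = ∈-filter⁺ (λ y → ¬? (y ≟ᵛ x))

      fF : IsFace k n F
      fF = Unique.filter⁺ (λ y → ¬? (y ≟ᵛ x)) (proj₁ fH) , All.tabulate (λ m → face-InV fH (F⊆H m)) ,
           λ I J m m′ → proj₂ (proj₂ fH) I J (F⊆H m) (F⊆H m′)

      -- An arc crossing (p , u) would cross (p , w), (q , u) or (q , w) in `H`, or contradict the
      -- choice of p or u as nearest, or be the dropped arc (q , w) itself.
      new-arc : ∀ {w′ p′} → Node F (suc r) (w′ ∷ p′) → ¬ Bad p u p′ w′ × ¬ Bad p′ w′ p u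
      new-arc {w′} {p′} nd@(y , y∈F , e) = right , left
        where
        nH : Node H (suc r) (w′ ∷ p′)
        nH = Node-⊆ F⊆H nd
        right : ¬ Bad p u p′ w′
        right (l , h , lt) with <-cmp w′ w | Lex<-cmp p′ q
        ... | tri> _ _ w<w′ | _ = no-cross fH r<k a-node nH (l , <-trans h u<w , w<w′)
        ... | tri≈ _ refl _ | inj₁ p′<q =
          a-nearest y (F⊆H y∈F) (subst (λ z → Lex< z q) (sym (∷-injectiveʳ e)) p′<q , ∷-injectiveˡ e)
            (subst (Lex< p) (sym (∷-injectiveʳ e)) l)
        ... | tri≈ _ refl _ | inj₂ (inj₁ refl) = F∌x (subst (_∈ F) (unique (F⊆H y∈F) e) y∈F)
        ... | tri≈ _ refl _ | inj₂ (inj₂ q<p′) = no-cross fH r<k b-node nH (q<p′ , h , u<w)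
        ... | tri< w′<w _ _ | inj₁ p′<q = no-cross fH r<k nH x-node (p′<q , <-trans hd-q<u lt , w′<w)
        ... | tri< w′<w _ _ | inj₂ (inj₁ refl) =
          b-nearest y (F⊆H y∈F) (∷-injectiveʳ e , subst (_< w) (sym (∷-injectiveˡ e)) w′<w)
            (subst (u <_) (sym (∷-injectiveˡ e)) lt)
        ... | tri< w′<w _ _ | inj₂ (inj₂ q<p′) = no-cross fH r<k b-node nH (q<p′ , h , lt)
        left : ¬ Bad p′ w′ p u
        left (l , h , lt) with hd q <? w′
        ... | yes q<w′ = no-cross fH r<k nH b-node (Lex<-trans l p<q , q<w′ , lt)
        ... | no  _    = no-cross fH r<k nH a-node (l , h , <-trans lt u<w)

      new-column : ∃ λ x′ → InV k n x′ × pre x′ (suc r) ≡ u ∷ p × NoncrossingWith F x′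
      new-column = complete-node fF r<k (a , ∈-F a∈H a≢x , refl) (≤-<-trans (Lex<-hd p<q) hd-q<u)
        (node-≤ fH r<k b-node) new-arc

      x′ : Vect
      x′ = proj₁ new-column

      x′-pre : pre x′ (suc r) ≡ u ∷ p
      x′-pre = proj₁ (proj₂ (proj₂ new-column))

      x′∉F : x′ ∉ F
      x′∉F m = no-cross fH r<k (x′ , F⊆H m , x′-pre) x-node (p<q , hd-q<u , u<w)

      flipped : ∃ λ G → MaxFace k n G × (x′ ∷ F) ⊆ G
      flipped = extend (face-∷ fF (proj₁ (proj₂ new-column)) x′∉F (proj₂ (proj₂ (proj₂ new-column))))

      G : Face
      G = proj₁ flipped

      mG : MaxFace k n G
      mG = proj₁ (proj₂ flipped)

      fG : IsFace k n G
      fG = proj₁ mG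

      ∈-G : ∀ {y} → y ∈ H → y ≢ x → y ∈ G
      ∈-G m ne = proj₂ (proj₂ flipped) (there (∈-F m ne))

      low-nodes⁺ : ∀ {c t} → c ≤ r → Node H c t → Node G c t
      low-nodes⁺ {c} c≤r (y , y∈H , refl) with y ≟ᵛ x
      ... | no  y≢x  = y , ∈-G y∈H y≢x , refl
      -- The prefixes of `x` up to length r survive in the column `b`.
      ... | yes refl = b , ∈-G b∈H b≢x , pre-≤ c≤r bq

      -- The nodes of `H` in these levels all lie in `G`, so a node of `G` is compatible with `H`,
      -- and `level-max` applies.
      low-nodes⁻ : ∀ {c t} → c ≤ r → Node G c t → Node H c t
      low-nodes⁻ {zero}  _   (_ , _ , refl) = root-node mH
      low-nodes⁻ {suc c} c<r nd@(_ , _ , refl) = level-max mH c<k (low-nodes⁻ (<⇒≤ c<r) (Node-tail nd))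
        (node-< fG c<k nd) (node-≤ fG c<k nd) λ nd′ →
          no-cross fG c<k nd (low-nodes⁺ c<r nd′) , no-cross fG c<k (low-nodes⁺ c<r nd′) nd
        where
        c<k : c < k
        c<k = <-trans c<r r<k

      -- A larger entry after t would be crossed by the arc from the left neighbour of t to M H t.
      -- Should that arc be the one of `x`, the arc (p , w) further to the left takes its place.
      level-bound : ∀ {v t} → Node G (suc r) (v ∷ t) → v ≤ M H t
      level-bound {v} {t} nd with v ≤? M H t
      ... | yes le = le
      ... | no  gt = ⊥-elim (crossed (left-neighbour mH r<k t-node t≢first))
        where
        t-node : Node H r t
        t-node = low-nodes⁻ ≤-refl (Node-tail nd)
        t≢first : t ≢ first r
        t≢first refl = gt (≤-trans (node-≤ fG r<k nd) (M-first mH r<k))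
        hd-t< : hd t < M H t
        hd-t< = node-< fH r<k (M-node fH r<k t-node)
        crossed : ¬ (∃ λ s → Lex< s t × Node H (suc r) (M H t ∷ s))
        crossed (s , l , (y , y∈H , e)) with y ≟ᵛ x
        ... | no y≢x = no-cross fG r<k (y , ∈-G y∈H y≢x , e) nd (l , hd-t< , ≰⇒> gt)
        ... | yes refl = no-cross fG r<k (a , ∈-G a∈H a≢x , cong (_∷ p) (trans aw (∷-injectiveˡ e))) nd
          (Lex<-trans p<q (subst (λ z → Lex< z t) (sym (∷-injectiveʳ e)) l) , hd-t< , ≰⇒> gt)

      M-≤ : ∀ {t} → t ≺ q → M G t ≤ M H t
      M-≤ {t} (inj₁ lt) = M-bounded {G} {t} (λ nd → M-upper (low-nodes⁻ (subst (length t <_) (length-pre x r) lt) nd))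
      M-≤ {t} (inj₂ (e , _)) = M-bounded {G} {t} (λ nd → level-bound (subst (λ z → Node G (suc z) _) (trans e (length-pre x r)) nd))

      -- If the bracket at q kept its value, which is at least w, its arc would cross the new arc (p
      -- , u).
      M-< : M G q < M H q
      M-< = ≤∧≢⇒< (level-bound q-top) λ e → no-cross fG r<k (x′ , proj₂ (proj₂ flipped) (here refl) , x′-pre) q-top
              (p<q , hd-q<u , <-≤-trans u<w (subst (w ≤_) (sym e) (M-upper x-node)))
        where
        q-top : Node G (suc r) (M G q ∷ q)
        q-top = M-node fG r<k (low-nodes⁺ ≤-refl (x , x∈H , refl))

      key-decreases : key G < key H
      key-decreases = key-<⁺ {G} {H} fG (node-∈-prefixes fH r<k (x , x∈H , refl)) M-≤ M-<

    flip : ∃ λ G → MaxFace k n G × key G < key H × (∀ {y} → y ∈ H → y ≢ x → y ∈ G)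
    flip with nearest-left | nearest-below
    ... | a , a∈H , (p<q , aw) , a-near | b , b∈H , (bq , u<w) , b-near = G , mG , key-decreases , ∈-G
      where open Step a∈H p<q aw a-near b∈H bq u<w b-near

  -- The column to exchange passes through an arc that `G` lacks, so it is not in `G`.
  descent : ∀ {G H} → MaxFace k n G → MaxFace k n H → key G < key H →
    ∃ λ x → x ∈ H × x ∉ G × ∃ λ G′ → MaxFace k n G′ × key G′ < key H × (∀ {y} → y ∈ H → y ≢ x → y ∈ G′)
  descent {G} {H} mG mH lt with flippable-difference mG mH lt
  ... | r , w , q , r<k , (x , x∈H , refl) , ∉G , fl with flippable-column (k ∸ r) mH r<k ≤-refl x∈H fl
  ...   | c , y , r≤c , c<k , y∈H , e , fl′ , unique =
    y , y∈H , (λ y∈G → ∉G (y , y∈G , e)) , Flip.flip mH c<k y∈H fl′ unique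

  -- The arcs of the digraph and the shelling

  -- Up to the pushed row the brackets given by J are matched by those of K, so replacing J by `J′`
  -- lowers no bracket there. But the arc of J in that row is lost, so some bracket must rise.
  arc-key : ∀ {G H} → Arc k n G H → key G < key H
  arc-key (arc F cod I a₁ zero (a₁<0 , _) K pc J′ ne mJ′ mG mH G≋ H≋) = ⊥-elim (n≮0 a₁<0)
  arc-key {G} {H} (arc F (fF , _) I a₁ (suc r) (_ , _ , ((I∈F , _) , _ , r<k , _ , x<N , marked)) K
    (((K∈F , _) , K<x , x<K) , _) J′ J≢J′ mJ′ mG mH G≋ H≋) =
    subst (key G <_) (sym (key-≋ H≋)) G<J′
    where
    x : ℕ
    x = at I (suc r)
    J : Vect
    J = pushed K (suc r) I
    I-length : length I ≡ k
    I-length = proj₁ (face-InV fF I∈F)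
    K-length : length K ≡ k
    K-length = proj₁ (face-InV fF K∈F)
    r≤K : r ≤ length K
    r≤K = subst (r ≤_) (sym K-length) (<⇒≤ r<k)
    J∈G : J ∈ G
    J∈G = proj₂ G≋ (here refl)
    fG : IsFace k n G
    fG = proj₁ mG
    fJ′ : IsFace k n (J′ ∷ F)
    fJ′ = proj₁ mJ′
    J-pre : pre J r ≡ pre K r
    J-pre = pre-pushed r K _ r≤K
    J-at : at J (suc r) ≡ x
    J-at = at-take-++ r K x _ r≤K

    J′∉F : J′ ∉ F
    J′∉F m with proj₁ fJ′
    ... | J′∉ ∷ _ = All.All¬⇒¬Any J′∉ m

    -- Otherwise `G` has the elements of `F` and lies properly in the face `J′ ∷ F`, against its
    -- maximality.
    J∉F : J ∉ F
    J∉F m = J′∉F (G⊆F (proj₂ mG (J′ ∷ F) fJ′ (there ∘ G⊆F) (here refl)))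
      where
      G⊆F : G ⊆ F
      G⊆F m′ with proj₁ G≋ m′
      ... | here refl = m
      ... | there m″  = m″

    -- Otherwise the arcs of I and K in this row cross. With `I≢K` this puts the prefix of K
    -- strictly below that of I.
    I≰K : ¬ Lex< (pre I r) (pre K r)
    I≰K l = no-cross fF r<k (I , I∈F , refl) (K , K∈F , refl) (l , subst (_< x) (sym (hd-pre K r)) K<x , x<K)

    I≢K : pre I r ≢ pre K r
    I≢K e = J∉F (subst (_∈ F) (sym J≡I) I∈F)
      where
      J≡I : J ≡ I
      J≡I = trans (cong (_++ (x ∷ drop (suc r) I)) (sym (reverse-injective
              (trans (sym (pre-take I r (subst (r ≤_) (sym I-length) (<⇒≤ r<k)))) (trans e (pre-take K r r≤K))))))
            (take-at-drop r I (subst (r <_) (sym I-length) r<k))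

    -- The mark makes the prefix of I the least one followed by x in the table, while that of K is
    -- smaller still.
    prefix-unused : ¬ Node F (suc r) (x ∷ pre K r)
    prefix-unused (C , C∈F , e) with C ≟ᵛ I
    ... | yes refl = I≢K (∷-injectiveʳ e)
    ... | no C≢I = [ precedes , agrees ]′ (marked C (C∈F , C≢top) (∷-injectiveˡ e) C≢I)
      where
      -- In this row `top` has the entry n - k + r + 1, just above the range of marked values.
      C≢top : C ≢ top k n
      C≢top C≡top = <⇒≢ x<N (trans (sym (∷-injectiveˡ e))
        (trans (cong (λ z → at z (suc r)) C≡top) (trans (at-top k n r r<k) (cong suc (+-comm (n ∸ k) r)))))
      I-take : reverse (take (suc r) I) ≡ pre I (suc r)
      I-take = sym (pre-take I (suc r) (subst (suc r ≤_) (sym I-length) r<k))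
      C-take : reverse (take (suc r) C) ≡ x ∷ pre K r
      C-take = trans (sym (pre-take C (suc r) (subst (suc r ≤_) (sym (proj₁ (face-InV fF C∈F))) r<k))) e
      precedes : ¬ RevLex< (take (suc r) I) (take (suc r) C)
      precedes l with subst₂ Lex< I-take C-take l
      ... | here x<x = <-irrefl refl x<x
      ... | there l′ = I≰K l′
      agrees : ¬ (take (suc r) I ≡ take (suc r) C × Lex< (drop (suc r) C) (drop (suc r) I))
      agrees (t , _) = I≢K (∷-injectiveʳ (trans (sym I-take) (trans (cong reverse t) C-take)))

    prefix-unused′ : ∀ {c z} → r ≤ c → z ∈ F → pre z (suc c) ≢ pre J (suc c)
    prefix-unused′ {z = z} r≤c z∈F e =
      prefix-unused (z , z∈F , trans (pre-≤ (s≤s r≤c) e) (cong₂ _∷_ J-at J-pre))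

    -- J shares its first r entries with K, and its next entry x is below that of K.
    low : ∀ {q} → length q ≤ r → M G q ≤ M (J′ ∷ F) q
    low {q} l = M-bounded {G} {q} bound
      where
      bound : ∀ {v} → Node G (suc (length q)) (v ∷ q) → v ≤ M (J′ ∷ F) q
      bound (z , z∈G , e) with proj₁ G≋ z∈G
      ... | there z∈F = M-upper (z , there z∈F , e)
      ... | here refl with m≤n⇒m<n∨m≡n l
      ...   | inj₁ l′ = M-upper (K , there K∈F , trans (sym (pre-≤ l′ J-pre)) e)
      ...   | inj₂ q≡r = ≤-trans (≤-reflexive v≡x) (≤-trans (<⇒≤ x<K) (M-upper (K , there K∈F , cong (at K (suc r) ∷_) (sym q≡K))))
        where
        e′ : at J (suc r) ∷ pre J r ≡ _ ∷ q
        e′ = subst (λ c → pre J (suc c) ≡ _ ∷ q) q≡r e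
        v≡x : _ ≡ x
        v≡x = trans (sym (∷-injectiveˡ e′)) J-at
        q≡K : q ≡ pre K r
        q≡K = trans (sym (∷-injectiveʳ e′)) J-pre

    ≺⇒≤ : ∀ {p q} → p ≺ q → length p ≤ length q
    ≺⇒≤ (inj₁ l)       = <⇒≤ l
    ≺⇒≤ (inj₂ (e , _)) = ≤-reflexive e

    -- If `J′` had this prefix, it would leave J at a later level c. The arc of J there is
    -- compatible with `J′`, whose prefix is the same, and with `F`, since both lie in `G`.
    -- Maximality would make it a node of `J′ ∷ F`, but no column there has it.
    new-prefix : ¬ Node (J′ ∷ F) (suc r) (pre J (suc r))
    new-prefix (z , there z∈F , e) = prefix-unused′ ≤-refl z∈F e
    new-prefix (_ , here refl , e)
      with pre-difference (suc r) r<k (proj₁ (face-InV fG J∈G)) (proj₁ (face-InV fJ′ (here refl))) (J≢J′ ∘ sym) (sym e)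
    ... | c , r<c , c<k , ec , differ = absurd
        (level-max mJ′ c<k (J′ , here refl , sym ec) (node-< fG c<k J-node) (node-≤ fG c<k J-node) compatible)
      where
      J-node : Node G (suc c) (at J (suc c) ∷ pre J c)
      J-node = J , J∈G , refl
      compatible : ∀ {w q} → Node (J′ ∷ F) (suc c) (w ∷ q) →
        ¬ Bad (pre J c) (at J (suc c)) q w × ¬ Bad q w (pre J c) (at J (suc c))
      compatible (_ , here refl , refl) =
        (λ (l , _) → Lex<-irrefl (subst (λ z → Lex< z _) ec l)) , (λ (l , _) → Lex<-irrefl (subst (Lex< _) ec l))
      compatible (z , there z∈F , e′) = no-cross fG c<k J-node z-node , no-cross fG c<k z-node J-node
        where z-node = z , proj₂ G≋ (there z∈F) , e′
      absurd : ¬ Node (J′ ∷ F) (suc c) (at J (suc c) ∷ pre J c)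
      absurd (_ , here refl , e′) = differ (sym (∷-injectiveˡ e′))
      absurd (z , there z∈F , e′) = prefix-unused′ (<⇒≤ r<c) z∈F e′

    -- Without a strict rise up to length r all these brackets agree, and so do the nodes of length
    -- r + 1, against `new-prefix`.
    G<J′ : key G < key (J′ ∷ F)
    G<J′ with any? (λ p → (length p ≤? r) ×-dec (M G p <? M (J′ ∷ F) p)) prefixes
    ... | yes some with find some
    ...   | p , p∈ , l , lt = key-<⁺ {G} {J′ ∷ F} fG p∈ (λ q≺p → low (≤-trans (≺⇒≤ q≺p) l)) lt
    G<J′ | no none = ⊥-elim (new-prefix (proj₁ (same-nodes (suc r) mG mJ′ r<k M-eq) (J , J∈G , refl)))
      where
      M-eq : ∀ {q} → q ∈ prefixes → length q < suc r → M G q ≡ M (J′ ∷ F) q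
      M-eq m (s≤s l) = ≤-antisym (low l) (≮⇒≥ (λ lt → none (lose m (l , lt))))

  path-key : ∀ {G H} → TransClosure (Arc k n) G H → key G < key H
  path-key [ a ]   = arc-key a
  path-key (a ∷ p) = <-trans (arc-key a) (path-key p)

  open Insertion key using (sort; sort-All; sort-sorted; sort-∋)

  module _ (order : List Face) (all-max : All (MaxFace k n) order)
    (sorted : AllPairs (λ G H → key G < key H) order)
    (order-complete : ∀ G → MaxFace k n G → ∃ λ (i : Fin (length order)) → lookup order i ≋ G) where

    order-max : ∀ i → MaxFace k n (lookup order i)
    order-max i = All.lookup all-max (∈-lookup i)

    order-< : ∀ {i j} → i Fin.< j → key (lookup order i) < key (lookup order j)
    order-< = AllPairs-lookup sorted

    order-<⁻ : ∀ i j → key (lookup order i) < key (lookup order j) → i Fin.< j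
    order-<⁻ i j lt with Fin.<-cmp i j
    ... | tri< a _ _    = a
    ... | tri≈ _ refl _ = ⊥-elim (<-irrefl refl lt)
    ... | tri> _ _ c    = ⊥-elim (<-asym lt (order-< c))

    order-injective : ∀ i j → lookup order i ≋ lookup order j → i ≡ j
    order-injective i j e with Fin.<-cmp i j
    ... | tri< a _ _ = ⊥-elim (<-irrefl (key-≋ e) (order-< a))
    ... | tri≈ _ q _ = q
    ... | tri> _ _ c = ⊥-elim (<-irrefl (sym (key-≋ e)) (order-< c))

    -- The face σ misses x because it lies in `G`. All of `H` except x lies in an earlier face, so
    -- the maximality of σ leaves x as the only missing vector.
    order-shelling : Shelling order
    order-shelling j _ σ ((σ! , σ⊆H , i , i<j , σ⊆G) , σ-max)
      with descent (order-max i) (order-max j) (order-< i<j)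
    ... | x , x∈H , x∉G , G′ , mG′ , lt , H-x⊆G′ with order-complete G′ mG′
    ...   | i′ , i′≋G′ = trans (+-comm (length σ) 1)
              -- Lists without repetition that have the same elements have the same length.
              (↭-length (∼bag⇒↭ (unique∧set⇒bag (All.¬Any⇒All¬ _ (x∉G ∘ σ⊆G) ∷ σ!) H! (mk⇔ to from))))
      where
      H : Face
      H = lookup order j
      H! : Unique H
      H! = proj₁ (proj₁ (order-max j))
      ≢x? : ∀ y → Dec (y ≢ x)
      ≢x? y = ¬? (y ≟ᵛ x)
      τ : Face
      τ = filter ≢x? H
      τ⊆σ : τ ⊆ σ
      τ⊆σ = σ-max τ
        (Unique.filter⁺ ≢x? H! , (λ m → proj₁ (∈-filter⁻ ≢x? {xs = H} m)) , i′ ,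
          order-<⁻ i′ j (subst (_< key H) (sym (key-≋ i′≋G′)) lt) ,
          (λ m → let y∈H , y≢x = ∈-filter⁻ ≢x? {xs = H} m in proj₂ i′≋G′ (H-x⊆G′ y∈H y≢x)))
        (λ m → ∈-filter⁺ ≢x? (σ⊆H m) (λ { refl → x∉G (σ⊆G m) }))
      to : ∀ {y} → y ∈ x ∷ σ → y ∈ H
      to (here refl) = x∈H
      to (there m)   = σ⊆H m
      from : ∀ {y} → y ∈ H → y ∈ x ∷ σ
      from {y} m with y ≟ᵛ x
      ... | yes y≡x = here y≡x
      ... | no  y≢x = there (τ⊆σ (∈-filter⁺ ≢x? m y≢x))

    sorted-shelling : ShellingLinearExtension k n order
    sorted-shelling =
      (all-max , order-complete , order-injective) , (λ i j p → order-<⁻ i j (path-key p)) , order-shelling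

  -- Sorting may keep another list with the same key; by `key-injective` it is the same face.
  sort-complete : ∀ {L} → All (MaxFace k n) L → (∀ {G} → MaxFace k n G → ∃ λ H → H ∈ L × G ≋ H) →
    ∀ G → MaxFace k n G → ∃ λ (i : Fin (length (sort L))) → lookup (sort L) i ≋ G
  sort-complete {L} all-max complete G mG with complete mG
  ... | H , H∈ , G≋H with sort-∋ L H∈
  ...   | H′ , m , e = Any.index m , key-injective (All.lookup (sort-All L all-max) (∈-lookup (Any.index m))) mG
            (trans (cong key (sym (Any.lookup-index m))) (trans e (sym (key-≋ G≋H))))

theorem2p17 : (k n : ℕ) → 1 ≤ k → k < n →
    Acyclic k n × Σ (List Face) (ShellingLinearExtension k n)
theorem2p17 k n _ k<n = (λ G _ p → <-irrefl refl (path-key p)) , sort candidates ,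
  sorted-shelling (sort candidates) (sort-All candidates candidates-max) (sort-sorted candidates)
    (sort-complete candidates-max candidates-complete)
  where
  open Complex k n k<n
  open Insertion key using (sort; sort-All; sort-sorted)
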